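{- The construction $\mathsf{C}$ is a functor from the category of unitary magmas to the category of (nonsymmetric) operads: for every unitary magma $\mathcal{M}$, the graded vector space $\mathsf{C}\mathcal{M}$ with its partial compositions $\circ_i$ and unit $\mathbf{u}$ is an operad; for every unitary magma morphism $\theta:\mathcal{M}_1\to\mathcal{M}_2$, the linear map $\mathsf{C}\theta:\mathsf{C}\mathcal{M}_1\to\mathsf{C}\mathcal{M}_2$ is an operad morphism; and $\mathsf{C}$ preserves identities and compositions. Moreover, $\mathsf{C}$ respects injections and surjections: if $\theta$ is injective (resp. surjective), then $\mathsf{C}\theta$ is injective (resp. surjective).
   Context: Let $\mathbb{K}$ be a field of characteristic zero and $[n]=\{1,\dots,n\}$. A unitary magma is a set $\mathcal{M}$ with a binary operation $\star$ (not assumed associative) having a two-sided unit $\mathbb{1}_{\mathcal{M}}$; morphisms preserve the operation and the unit. Operad means nonsymmetric operad in $\mathbb{K}$-vector spaces: a graded vector space $\mathcal{O}=\bigoplus_{n\ge1}\mathcal{O}(n)$ with linear maps $\circ_i:\mathcal{O}(n)\otimes\mathcal{O}(m)\to\mathcal{O}(n+m-1)$ ($n,m\ge1$, $i\in[n]$) and an element $\mathbb{1}\in\mathcal{O}(1)$ such that, for $x\in\mathcal{O}(n)$, $y\in\mathcal{O}(m)$, $z\in\mathcal{O}(k)$: $(x\circ_i y)\circ_{i+j-1}z=x\circ_i(y\circ_j z)$ for $i\in[n],j\in[m]$; $(x\circ_i y)\circ_{j+m-1}z=(x\circ_j z)\circ_i y$ for $i<j$ in $[n]$; $\mathbb{1}\circ_1x=x=x\circ_i\mathbb{1}$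 for $i \in [n]$. Operad morphisms are linear maps that respect arities, units and partial compositions. An $\mathcal{M}$-clique of arity $n\ge1$ is a map $\mathfrak{p}$ assigning a label $\mathfrak{p}(x,y)\in\mathcal{M}$ to each arc $(x,y)$, $1\le x<y\le n+1$; by convention the only $\mathcal{M}$-clique of arity $1$ is $\mathbf{u}$, with $\mathbf{u}(1,2)=\mathbb{1}_{\mathcal{M}}$. Write $\mathfrak{p}_0:=\mathfrak{p}(1,n+1)$ and $\mathfrak{p}_i:=\mathfrak{p}(i,i+1)$ for $i\in[n]$. $\mathsf{C}\mathcal{M}(n)$ is the vector space with basis the $\mathcal{M}$-cliques of arity $n$, and $\mathsf{C}\mathcal{M}=\bigoplus_{n\ge1}\mathsf{C}\mathcal{M}(n)$. For $\mathcal{M}$-cliques $\mathfrak{p},\mathfrak{q}$ of arities $n,m$ and $i\in[n]$, $\mathfrak{p}\circ_i\mathfrak{q}$ is the $\mathcal{M}$-clique of arity $n+m-1$ with, for $1\le x<y\le n+m$, $$(\mathfrak{p}\circ_i\mathfrak{q})(x,y)=\begin{cases}\mathfrak{p}(x,y)&\text{if }y\le i,\\ \mathfrak{p}(x,y-m+1)&\text{if }x\le i<i+m\le y,\ (x,y)\ne(i,i+m),\\ \mathfrak{p}(x-m+1,y-m+1)&\text{if }i+m\le x,\\ \mathfrak{q}(x-i+1,y-i+1)&\text{if }i\le x<y\le i+m,\ (x,y)\ne(i,i+m),\\ \mathfrak{p}_i\star\mathfrak{q}_0&\text{if }(x,y)=(i,i+m),\\ \mathbb{1}_{\mathcal{M}}&\text{otherwise},\end{cases}$$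 extended bilinearly. For a unitary magma morphism $\theta:\mathcal{M}_1\to\mathcal{M}_2$, $\mathsf{C}\theta$ is the linear map sending an $\mathcal{M}_1$-clique $\mathfrak{p}$ to the $\mathcal{M}_2$-clique of the same arity with $((\mathsf{C}\theta)(\mathfrak{p}))(x,y)=\theta(\mathfrak{p}(x,y))$. -}

module Defs where

open import Level using (Level; _⊔_) renaming (suc to lsuc)
open import Algebra.Apartness.Bundles using (HeytingCommutativeRing; HeytingField)
open import Algebra.Bundles using (CommutativeRing; UnitalMagma)
open import Algebra.Bundles.Raw using (RawMonoid)
import Algebra.Definitions.RawMonoid as RawMonoidDefinitions
open import Algebra.Module.Bundles.Raw using (RawModule; module RawModule)
import Algebra.Module.Morphism.Construct.Composition as ModuleComposition
import Algebra.Module.Morphism.Construct.Identity as ModuleIdentity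
open import Algebra.Module.Morphism.Structures using (module ModuleMorphisms)
open import Algebra.Module.Structures using (IsModule)
import Algebra.Morphism.Construct.Composition as MagmaComposition
import Algebra.Morphism.Construct.Identity as MagmaIdentity
open import Algebra.Morphism.Structures using (module MonoidMorphisms)
open import Data.List.Base using (List; []; _∷_; _++_; map; cartesianProductWith)
open import Data.Nat.Base
  using (ℕ; suc; _+_; _∸_; _≤_; _<_; z≤n; s≤s; NonZero)
open import Data.Nat.Properties
open import Data.Product.Base using (_×_; _,_; map₁; map₂)
open import Function.Base using (id)
open import Relation.Binary.Core using (Rel)
open import Relation.Binary.Bundles using (Setoid)
open import Relation.Binary.Structures using (IsEquivalence)
open import Relation.Binary.PropositionalEquality
  using (_≡_; sym; trans; cong; subst)
open import Relation.Nullary using (¬_; yes; no; _×-dec_)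

private
  variable
    r ℓr o e o₁ e₁ o₂ e₂ o₃ e₃ m ℓ x ℓx : Level

record Category o ℓ e : Set (lsuc (o ⊔ ℓ ⊔ e)) where
  infix  4 _≈_
  infixr 9 _∘ᶜ_
  field
    Obj       : Set o
    Hom       : Obj → Obj → Set ℓ
    _≈_       : ∀ {A B} → Rel (Hom A B) e
    idᶜ       : ∀ {A} → Hom A A
    _∘ᶜ_      : ∀ {A B C} → Hom B C → Hom A B → Hom A C
    equiv     : ∀ {A B} → IsEquivalence (_≈_ {A} {B})
    ∘-resp-≈  : ∀ {A B C} {f f′ : Hom B C} {g g′ : Hom A B} →
                f ≈ f′ → g ≈ g′ → f ∘ᶜ g ≈ f′ ∘ᶜ g′
    identityˡ : ∀ {A B} (f : Hom A B) → idᶜ ∘ᶜ f ≈ f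
    identityʳ : ∀ {A B} (f : Hom A B) → f ∘ᶜ idᶜ ≈ f
    assoc     : ∀ {A B C D} (f : Hom C D) (g : Hom B C) (h : Hom A B) →
                (f ∘ᶜ g) ∘ᶜ h ≈ f ∘ᶜ (g ∘ᶜ h)

record IsFunctor {o₁ ℓ₁ e₁ o₂ ℓ₂ e₂}
  (𝒞 : Category o₁ ℓ₁ e₁) (𝒟 : Category o₂ ℓ₂ e₂)
  (F₀ : Category.Obj 𝒞 → Category.Obj 𝒟)
  (F₁ : ∀ {A B} → Category.Hom 𝒞 A B → Category.Hom 𝒟 (F₀ A) (F₀ B))
  : Set (o₁ ⊔ ℓ₁ ⊔ e₁ ⊔ e₂) where
  private
    module 𝒞 = Category 𝒞
    module 𝒟 = Category 𝒟
  field
    F-resp-≈     : ∀ {A B} {f g : 𝒞.Hom A B} → f 𝒞.≈ g → F₁ f 𝒟.≈ F₁ g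
    identity     : ∀ {A} → F₁ (𝒞.idᶜ {A}) 𝒟.≈ 𝒟.idᶜ
    homomorphism : ∀ {A B C} (g : 𝒞.Hom B C) (f : 𝒞.Hom A B) →
                   F₁ (g 𝒞.∘ᶜ f) 𝒟.≈ F₁ g 𝒟.∘ᶜ F₁ f

scalars : ∀ {k ℓ₁ ℓ₂} → HeytingField k ℓ₁ ℓ₂ → CommutativeRing k ℓ₁
scalars K =
  HeytingCommutativeRing.commutativeRing (HeytingField.heytingCommutativeRing K)

CharacteristicZero : ∀ {k ℓ₁ ℓ₂} → HeytingField k ℓ₁ ℓ₂ → Set ℓ₁
CharacteristicZero K = ∀ n .{{_ : NonZero n}} → ¬ (n · 1# ≈ 0#)
  where
  open CommutativeRing (scalars K) using (_≈_; 0#; 1#; +-rawMonoid)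
  open RawMonoidDefinitions +-rawMonoid using () renaming (_×_ to infixr 8 _·_)

rawUnitalMagma : UnitalMagma m ℓ → RawMonoid m ℓ
rawUnitalMagma M = record
  { Carrier = M.Carrier ; _≈_ = M._≈_ ; _∙_ = M._∙_ ; ε = M.ε }
  where module M = UnitalMagma M

-- Monoid homomorphisms only refer to the raw operation and unit, so no
-- associativity is involved.
record UnitalMagmaHom (M N : UnitalMagma m ℓ) : Set (m ⊔ ℓ) where
  open MonoidMorphisms (rawUnitalMagma M) (rawUnitalMagma N)
  field
    ⟦_⟧            : UnitalMagma.Carrier M → UnitalMagma.Carrier N
    isHomomorphism : IsMonoidHomomorphism ⟦_⟧
  open IsMonoidHomomorphism isHomomorphism public

UnitalMagmas : ∀ m ℓ → Category (lsuc (m ⊔ ℓ)) (m ⊔ ℓ) (m ⊔ ℓ)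
UnitalMagmas m ℓ = record
  { Obj       = UnitalMagma m ℓ
  ; Hom       = UnitalMagmaHom
  ; _≈_       = λ {_} {N} θ θ′ → ∀ a → UnitalMagma._≈_ N (⟦ θ ⟧ a) (⟦ θ′ ⟧ a)
  ; idᶜ       = λ {M} → record
    { isHomomorphism =
        MagmaIdentity.isMonoidHomomorphism (rawUnitalMagma M) (UnitalMagma.refl M) }
  ; _∘ᶜ_      = λ {_} {_} {L} θ η → record
    { isHomomorphism = MagmaComposition.isMonoidHomomorphism
        (UnitalMagma.trans L) (isHomomorphism η) (isHomomorphism θ) }
  ; equiv     = λ {_} {N} → record
    { refl  = λ _ → UnitalMagma.refl N
    ; sym   = λ p a → UnitalMagma.sym N (p a)
    ; trans = λ p q a → UnitalMagma.trans N (p a) (q a) }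
  ; ∘-resp-≈  = λ {_} {_} {L} {f} {_} {_} {g′} p q a →
      UnitalMagma.trans L (⟦⟧-cong f (q a)) (p (⟦ g′ ⟧ a))
  ; identityˡ = λ {_} {N} _ _ → UnitalMagma.refl N
  ; identityʳ = λ {_} {N} _ _ → UnitalMagma.refl N
  ; assoc     = λ {_} {_} {_} {L} _ _ _ _ → UnitalMagma.refl L
  }
  where open UnitalMagmaHom

-- The index set [n] = {1, …, n}
record [_] (n : ℕ) : Set where
  constructor index
  field
    val    : ℕ
    .1≤val : 1 ≤ val
    .val≤n : val ≤ n

open [_] public

private
  variable
    a b c : ℕ

first : [ suc a ]
first = index 1 ≤-refl (s≤s z≤n)

inject : ∀ b → [ suc a ] → [ suc (a + b) ]
inject b (index i 1≤i i≤n) = index i 1≤i (≤-trans i≤n (s≤s (m≤m+n _ b)))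

-- i + j - 1 for i ∈ [n] and j ∈ [m], where n = suc a and m = suc b
_⊕_ : [ suc a ] → [ suc b ] → [ suc (a + b) ]
_⊕_ {a} {b} (index i 1≤i i≤n) (index j 1≤j j≤m) = index (i + j ∸ 1)
  (∸-monoˡ-≤ 1 (+-mono-≤ 1≤i 1≤j))
  (≤-trans (∸-monoˡ-≤ 1 (+-mono-≤ i≤n j≤m)) (≤-reflexive (+-suc a b)))

-- j + m - 1 for j ∈ [n], where n = suc a and m = suc b
shift : ∀ b → [ suc a ] → [ suc (a + b) ]
shift {a} b j = j ⊕ index (suc b) (s≤s z≤n) ≤-refl

+-swapʳ : ∀ a b c → (a + b) + c ≡ (a + c) + b
+-swapʳ a b c = trans (+-assoc a b c)
  (trans (cong (a +_) (+-comm b c)) (sym (+-assoc a c b)))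

-- Since arities are positive, components are numbered by arity - 1:
-- component a is the space O(a + 1).  A partial composition of arities
-- a + 1 and b + 1 then has arity (a + 1) + (b + 1) - 1 = (a + b) + 1.
record RawOperad (R : Set r) o e : Set (r ⊔ lsuc (o ⊔ e)) where
  field
    component : ℕ → RawModule R o e

  O : ℕ → Set o
  O a = RawModule.Carrierᴹ (component a)

  infix 4 _≈_
  _≈_ : Rel (O a) e
  _≈_ {a} = RawModule._≈ᴹ_ (component a)

  infix 8 _∘⟨_⟩_
  field
    _∘⟨_⟩_ : O a → [ suc a ] → O b → O (a + b)
    𝟙      : O 0

  cast : a ≡ b → O a → O b
  cast = subst O

record IsOperad (R : CommutativeRing r ℓr)
  (P : RawOperad (CommutativeRing.Carrier R) o e) : Set (r ⊔ ℓr ⊔ o ⊔ e) where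
  open RawOperad P
  open ModuleMorphisms using (IsModuleHomomorphism)
  field
    isModule : ∀ a → let open RawModule (component a) in
               IsModule R _≈ᴹ_ _+ᴹ_ 0ᴹ -ᴹ_ _*ₗ_ _*ᵣ_
    linearˡ  : (i : [ suc a ]) (y : O b) →
               IsModuleHomomorphism (component a) (component (a + b)) (λ x → x ∘⟨ i ⟩ y)
    linearʳ  : (x : O a) (i : [ suc a ]) →
               IsModuleHomomorphism (component b) (component (a + b)) (λ y → x ∘⟨ i ⟩ y)

    -- (x ∘ᵢ y) ∘ᵢ₊ⱼ₋₁ z = x ∘ᵢ (y ∘ⱼ z)
    series   : (x : O a) (y : O b) (z : O c) (i : [ suc a ]) (j : [ suc b ]) →
               cast (+-assoc a b c) ((x ∘⟨ i ⟩ y) ∘⟨ i ⊕ j ⟩ z) ≈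
               x ∘⟨ i ⟩ (y ∘⟨ j ⟩ z)
    -- (x ∘ᵢ y) ∘ⱼ₊ₘ₋₁ z = (x ∘ⱼ z) ∘ᵢ y
    parallel : (x : O a) (y : O b) (z : O c) (i j : [ suc a ]) → val i < val j →
               cast (+-swapʳ a b c) ((x ∘⟨ i ⟩ y) ∘⟨ shift b j ⟩ z) ≈
               (x ∘⟨ j ⟩ z) ∘⟨ inject c i ⟩ y
    unitˡ    : (x : O a) → 𝟙 ∘⟨ first ⟩ x ≈ x
    unitʳ    : (x : O a) (i : [ suc a ]) →
               cast (+-identityʳ a) (x ∘⟨ i ⟩ 𝟙) ≈ x

record Operad (R : CommutativeRing r ℓr) o e : Set (r ⊔ ℓr ⊔ lsuc (o ⊔ e)) where
  constructor operad
  field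
    rawOperad : RawOperad (CommutativeRing.Carrier R) o e
    isOperad  : IsOperad R rawOperad
  open RawOperad rawOperad public
  open IsOperad isOperad public

  module Component (a : ℕ) = IsModule (isModule a)

record IsOperadMorphism {R : Set r}
  (P : RawOperad R o₁ e₁) (Q : RawOperad R o₂ e₂)
  (f : ∀ {a} → RawOperad.O P a → RawOperad.O Q a)
  : Set (r ⊔ o₁ ⊔ e₁ ⊔ o₂ ⊔ e₂) where
  private
    module P = RawOperad P
    module Q = RawOperad Q
  open ModuleMorphisms using (IsModuleHomomorphism)
  field
    linear : ∀ a → IsModuleHomomorphism (P.component a) (Q.component a) f
    unit   : f P.𝟙 Q.≈ Q.𝟙
    comp   : (x : P.O a) (i : [ suc a ]) (y : P.O b) →
             f (x P.∘⟨ i ⟩ y) Q.≈ f x Q.∘⟨ i ⟩ f y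

  f-cong : ∀ {a} {x y : P.O a} → x P.≈ y → f x Q.≈ f y
  f-cong {a} = IsModuleHomomorphism.⟦⟧-cong (linear a)

record OperadHom {R : CommutativeRing r ℓr} (P : Operad R o₁ e₁) (Q : Operad R o₂ e₂)
  : Set (r ⊔ o₁ ⊔ e₁ ⊔ o₂ ⊔ e₂) where
  constructor operadHom
  field
    ⟦_⟧        : Operad.O P a → Operad.O Q a
    isMorphism : IsOperadMorphism (Operad.rawOperad P) (Operad.rawOperad Q) ⟦_⟧
  open IsOperadMorphism isMorphism public

Operads : (R : CommutativeRing r ℓr) → ∀ o e →
          Category (r ⊔ ℓr ⊔ lsuc (o ⊔ e)) (r ⊔ o ⊔ e) (o ⊔ e)
Operads R o e = record
  { Obj       = Operad R o e
  ; Hom       = OperadHom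
  ; _≈_       = λ {P} {Q} f g → ∀ {a} (x : O P a) → _≈_ Q (⟦ f ⟧ x) (⟦ g ⟧ x)
  ; idᶜ       = λ {P} → record
    { ⟦_⟧        = id
    ; isMorphism = record
      { linear = λ a → ModuleIdentity.isModuleHomomorphism (component P a) (≈-refl P)
      ; unit   = ≈-refl P
      ; comp   = λ _ _ _ → ≈-refl P } }
  ; _∘ᶜ_      = λ {P} {Q} {S} f g → record
    { ⟦_⟧        = λ x → ⟦ f ⟧ (⟦ g ⟧ x)
    ; isMorphism = record
      { linear = λ a → ModuleComposition.isModuleHomomorphism
                   (≈-trans S) (linear g a) (linear f a)
      ; unit   = ≈-trans S (f-cong f (unit g)) (unit f)
      ; comp   = λ x i y → ≈-trans S (f-cong f (comp g x i y)) (comp f _ i _) } }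
  ; equiv     = λ {P} {Q} → record
    { refl  = λ _ → ≈-refl Q
    ; sym   = λ p x → ≈-sym Q (p x)
    ; trans = λ p q x → ≈-trans Q (p x) (q x) }
  ; ∘-resp-≈  = λ {_} {_} {S} {f} p q x → ≈-trans S (f-cong f (q x)) (p _)
  ; identityˡ = λ {_} {Q} _ _ → ≈-refl Q
  ; identityʳ = λ {_} {Q} _ _ → ≈-refl Q
  ; assoc     = λ {_} {_} {_} {S} _ _ _ _ → ≈-refl S
  }
  where
  open Operad using (O; _≈_; component; module Component)
  open OperadHom

  ≈-refl : ∀ P {a} {x : O P a} → _≈_ P x x
  ≈-refl P {a} = Component.≈ᴹ-refl P a

  ≈-sym : ∀ P {a} {x y : O P a} → _≈_ P x y → _≈_ P y x
  ≈-sym P {a} = Component.≈ᴹ-sym P a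

  ≈-trans : ∀ P {a} {x y z : O P a} → _≈_ P x y → _≈_ P y z → _≈_ P x z
  ≈-trans P {a} = Component.≈ᴹ-trans P a

-- The free module on a setoid X: formal linear combinations of elements
-- of X, up to the congruence that reorders terms, collects like terms and drops zero terms
module FreeModule (R : CommutativeRing r ℓr) (X : Setoid x ℓx) where
  private
    module R = CommutativeRing R
    module X = Setoid X

  Combination : Set (r ⊔ x)
  Combination = List (R.Carrier × X.Carrier)

  infix 4 _≋_
  data _≋_ : Rel Combination (r ⊔ ℓr ⊔ x ⊔ ℓx) where
    []      : [] ≋ []
    cons    : ∀ {k l p q u v} → k R.≈ l → p X.≈ q → u ≋ v → (k , p) ∷ u ≋ (l , q) ∷ v
    swap    : ∀ s t u → s ∷ t ∷ u ≋ t ∷ s ∷ u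
    collect : ∀ k l p u → (k , p) ∷ (l , p) ∷ u ≋ (k R.+ l , p) ∷ u
    drop    : ∀ p u → (R.0# , p) ∷ u ≋ u
    ≋-sym   : ∀ {u v} → u ≋ v → v ≋ u
    ≋-trans : ∀ {u v w} → u ≋ v → v ≋ w → u ≋ w

  basis : X.Carrier → Combination
  basis p = (R.1# , p) ∷ []

  rawModule : RawModule R.Carrier (r ⊔ x) (r ⊔ ℓr ⊔ x ⊔ ℓx)
  rawModule = record
    { Carrierᴹ = Combination
    ; _≈ᴹ_     = _≋_
    ; _+ᴹ_     = _++_
    ; _*ₗ_     = λ k → map (map₁ (k R.*_))
    ; _*ᵣ_     = λ u k → map (map₁ (R._* k)) u
    ; 0ᴹ       = []
    ; -ᴹ_      = map (map₁ (λ k → R.- k))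
    }

-- The arcs (x , y), 1 ≤ x < y ≤ n + 1, of a clique of arity n
record Arc (n : ℕ) : Set where
  constructor arc
  field
    src tgt    : ℕ
    .1≤src     : 1 ≤ src
    .src<tgt   : src < tgt
    .tgt≤suc-n : tgt ≤ suc n

-- The cases in the definition of 𝔭 ∘ᵢ 𝔮, where m is the arity of 𝔮 and
-- (x , y) is an arc of the composite.  The cases exclude one another when
-- 1 ≤ m and x < y, so the order of the tests in `position` is immaterial.
data Position (i m x y : ℕ) : Set where
  before   : .(y ≤ i) → Position i m x y
  above    : .(x ≤ i) → .(i + m ≤ y) → .(¬ (x ≡ i × y ≡ i + m)) → Position i m x y
  after    : .(i + m ≤ x) → Position i m x y
  inside   : .(i ≤ x) → .(y ≤ i + m) → .(¬ (x ≡ i × y ≡ i + m)) → Position i m x y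
  glued    : .(x ≡ i × y ≡ i + m) → Position i m x y
  crossing : .(¬ (y ≤ i)) → .(¬ (x ≤ i × i + m ≤ y)) → .(¬ (i + m ≤ x)) →
             .(¬ (i ≤ x × y ≤ i + m)) → .(¬ (x ≡ i × y ≡ i + m)) → Position i m x y

position : ∀ i m x y → Position i m x y
position i m x y with (x ≟ i) ×-dec (y ≟ i + m)
... | yes eq = glued eq
... | no ≢ with y ≤? i
...   | yes y≤i = before y≤i
...   | no y≰i with (x ≤? i) ×-dec (i + m ≤? y)
...     | yes (x≤i , i+m≤y) = above x≤i i+m≤y ≢
...     | no ¬above with i + m ≤? x
...       | yes i+m≤x = after i+m≤x
...       | no i+m≰x with (i ≤? x) ×-dec (y ≤? i + m)
...         | yes (i≤x , y≤i+m) = inside i≤x y≤i+m ≢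
...         | no ¬inside = crossing y≰i ¬above i+m≰x ¬inside ≢

module Cliques (M : UnitalMagma m ℓ) where
  open UnitalMagma M renaming (refl to ≈-refl; sym to ≈-sym; trans to ≈-trans)

  record Clique (n : ℕ) : Set (m ⊔ ℓ) where
    field
      label   : Arc n → Carrier
      -- The only clique of arity 1 is 𝐮.
      trivial : n ≡ 1 → ∀ α → label α ≈ ε

  open Clique public

  clique : ℕ → Setoid (m ⊔ ℓ) ℓ
  clique n = record
    { Carrier       = Clique n
    ; _≈_           = λ p q → ∀ α → label p α ≈ label q α
    ; isEquivalence = record
      { refl  = λ _ → ≈-refl
      ; sym   = λ p≈q α → ≈-sym (p≈q α)
      ; trans = λ p≈q q≈s α → ≈-trans (p≈q α) (q≈s α) }
    }

  𝐮 : Clique 1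
  𝐮 = record { label = λ _ → ε ; trivial = λ _ _ → ≈-refl }

  base : Clique (suc a) → Carrier
  base {a} p = label p (arc 1 (suc (suc a)) ≤-refl (s≤s (s≤s z≤n)) ≤-refl)

  edge : ∀ {n} → Clique n → [ n ] → Carrier
  edge p (index i 1≤i i≤n) = label p (arc i (suc i) 1≤i ≤-refl (s≤s i≤n))

  private
    bound : ∀ {y} a b → y ≤ suc (suc (a + b)) → y ∸ suc b + 1 ≤ suc (suc a)
    bound {y} a b y≤ = begin
      y ∸ suc b + 1       ≡⟨ +-comm _ 1 ⟩
      suc (y ∸ suc b)     ≤⟨ s≤s (∸-monoˡ-≤ (suc b) y≤) ⟩
      suc (suc a + b ∸ b) ≡⟨ cong suc (m+n∸n≡m (suc a) b) ⟩
      suc (suc a)         ∎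
      where open ≤-Reasoning

    m≤n⇒m<n+1 : ∀ {m n} → m ≤ n → m < n + 1
    m≤n⇒m<n+1 {n = n} m≤n = ≤-trans (s≤s m≤n) (≤-reflexive (+-comm 1 n))

  -- p has arity n = suc a and q has arity m = suc b.
  labelAt : (p : Clique (suc a)) (I : [ suc a ]) (q : Clique (suc b)) (α : Arc (suc (a + b))) →
            Position (val I) (suc b) (Arc.src α) (Arc.tgt α) → Carrier
  labelAt p I@(index i 1≤i i≤n) q (arc x y 1≤x x<y y≤n+m) (before y≤i) =
    label p (arc x y 1≤x x<y (≤-trans y≤i (≤-trans i≤n (n≤1+n _))))
  labelAt {a} {b} p I@(index i 1≤i i≤n) q (arc x y 1≤x x<y y≤n+m) (above x≤i i+m≤y _) =
    label p (arc x (y ∸ suc b + 1) 1≤x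
      (m≤n⇒m<n+1 (≤-trans x≤i (m+n≤o⇒m≤o∸n i i+m≤y)))
      (bound a b y≤n+m))
  labelAt {a} {b} p I@(index i 1≤i i≤n) q (arc x y 1≤x x<y y≤n+m) (after i+m≤x) =
    label p (arc (x ∸ suc b + 1) (y ∸ suc b + 1) (m≤n+m 1 _)
      (+-monoˡ-< 1 (∸-monoˡ-< x<y (≤-trans (m≤n+m (suc b) i) i+m≤x)))
      (bound a b y≤n+m))
  labelAt p I@(index i 1≤i i≤n) q (arc x y 1≤x x<y y≤n+m) (inside i≤x y≤i+m _) =
    label q (arc (x ∸ i + 1) (y ∸ i + 1) (m≤n+m 1 _)
      (+-monoˡ-< 1 (∸-monoˡ-< x<y i≤x))
      (≤-trans (≤-reflexive (+-comm _ 1)) (s≤s (m≤n+o⇒m∸n≤o y i y≤i+m))))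
  labelAt p I q _ (glued _) = edge p I ∙ base q
  labelAt p I q _ (crossing _ _ _ _ _) = ε

  composeLabel : Clique (suc a) → [ suc a ] → Clique (suc b) → Arc (suc (a + b)) → Carrier
  composeLabel {b = b} p I q α =
    labelAt p I q α (position (val I) (suc b) (Arc.src α) (Arc.tgt α))

  compose : Clique (suc a) → [ suc a ] → Clique (suc b) → Clique (suc (a + b))
  compose {a} {b} p I q = record
    { label   = composeLabel p I q
    ; trivial = λ n≡1 α → labelAt-trivial
        (cong suc (m+n≡0⇒m≡0 a (suc-injective n≡1)))
        (cong suc (m+n≡0⇒n≡0 a (suc-injective n≡1)))
        α (position (val I) (suc b) (Arc.src α) (Arc.tgt α))
    }
    where
    labelAt-trivial : suc a ≡ 1 → suc b ≡ 1 → ∀ α pos → labelAt p I q α pos ≈ ε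
    labelAt-trivial a≡ b≡ α (before _)     = trivial p a≡ _
    labelAt-trivial a≡ b≡ α (above _ _ _)  = trivial p a≡ _
    labelAt-trivial a≡ b≡ α (after _)      = trivial p a≡ _
    labelAt-trivial a≡ b≡ α (inside _ _ _) = trivial q b≡ _
    labelAt-trivial a≡ b≡ α (glued _)      =
      ≈-trans (∙-cong (trivial p a≡ _) (trivial q b≡ _)) (identityˡ ε)
    labelAt-trivial a≡ b≡ α (crossing _ _ _ _ _) = ≈-refl

module _ {M N : UnitalMagma m ℓ} (θ : UnitalMagmaHom M N) where
  private
    module N = UnitalMagma N
  open UnitalMagmaHom θ

  relabel : ∀ {n} → Cliques.Clique M n → Cliques.Clique N n
  relabel p = record
    { label   = λ α → ⟦ Cliques.label p α ⟧
    ; trivial = λ n≡1 α → N.trans (⟦⟧-cong (Cliques.trivial p n≡1 α)) ε-homo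
    }

module _ (R : CommutativeRing r ℓr) where
  private
    module R = CommutativeRing R

  C : UnitalMagma m ℓ → RawOperad R.Carrier (r ⊔ m ⊔ ℓ) (r ⊔ ℓr ⊔ m ⊔ ℓ)
  C M = record
    { component = λ a → FreeModule.rawModule R (clique (suc a))
    ; _∘⟨_⟩_    = λ u i v →
        cartesianProductWith (λ (k , p) (l , q) → k R.* l , compose p i q) u v
    ; 𝟙         = FreeModule.basis R (clique 1) 𝐮
    }
    where open Cliques M

  C₁ : {M N : UnitalMagma m ℓ} → UnitalMagmaHom M N →
       RawOperad.O (C M) a → RawOperad.O (C N) a
  C₁ θ = map (map₂ (relabel θ))

{-# OPTIONS --safe #-}
module Submission where

-- The proof separates the algebra of free modules from the geometry of arcs.
--
-- Free modules.  Partial composition extends a map of cliques bilinearly, so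
-- each operad axiom follows from the corresponding equation between cliques
-- once formal combinations can be rearranged: cartesianProductWith-assoc
-- covers series composition and cartesianProductWith-interchange parallel
-- composition.
--
-- Arcs.  Every arc of the composite of p and q at i is the image of an arc
-- of p that is not the i-th edge (outerArc), the image of an arc of q that
-- is not the base (innerArc), the common image of that edge and that base,
-- or the image of no arc at all; these four exclusive origins give the label
-- p, q, the product, or the unit.  For an iterated composite of p, q and r,
-- the embeddings of arcs along the two bracketings coincide, so that on both
-- sides a label is read off from the arcs of p, q and r that it comes from.
-- The case needing care is a middle clique of arity 1 in a series
-- composition: there the label is a product of three factors, which need not
-- associate, but the middle factor is the unit because the only clique of
-- arity 1 is trivial.
--
-- Injectivity.  Equality of labels is not assumed decidable, so no retraction
-- of an injection onto its image is available, and a derivation of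
-- equality between images may pass through basis elements outside the image.
-- The predicate Null removes these detours: it derives that a combination
-- is zero only by discarding zero terms and collecting like terms, and hence
-- never introduces a basis element.  Both rules are invertible (zero⁻¹ and
-- merge⁻¹), which makes Null invariant under the congruence (Null-resp-≋);
-- a derivation of Null for an image then pulls back along an injection
-- (Null-reflect).
--
-- Surjectivity.  Chosen preimages of labels assemble to a preimage of a
-- clique; in arity 1 the chosen preimages are replaced by the unit.

open import Defs
open import Level using (Level; _⊔_)
open import Algebra.Apartness.Bundles using (HeytingField)
open import Algebra.Bundles using (CommutativeRing; UnitalMagma)
open import Algebra.Module.Bundles.Raw using (module RawModule)
open import Algebra.Module.Morphism.Structures using (module ModuleMorphisms)
open import Algebra.Module.Structures using (IsModule)
open import Algebra.Properties.CommutativeSemigroup using (x∙yz≈y∙xz; xy∙z≈xz∙y)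
import Algebra.Properties.Ring as RingProperties
open import Data.Empty using (⊥-elim; ⊥-elim-irr)
open import Data.List.Base using ([]; _∷_; _++_; map; cartesianProductWith)
open import Data.List.Properties
  using ( map-++; map-∘; map-id; ++-assoc; ++-identityʳ
        ; cartesianProductWith-zeroʳ; cartesianProductWith-distribʳ-++)
import Data.List.Relation.Binary.Permutation.Setoid as Permutation
import Data.List.Relation.Binary.Permutation.Setoid.Properties as PermutationProperties
open import Data.List.Relation.Binary.Pointwise using (Pointwise; []; _∷_)
open import Data.Nat.Base
  using (ℕ; zero; suc; pred; _+_; _∸_; _≤_; _<_; z≤n; s≤s; s≤s⁻¹)
open import Data.Nat.Properties
open import Data.Product.Base
  using (Σ-syntax; ∃; ∃₂; _×_; _,_; proj₁; proj₂; map₁; map₂)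
  renaming (swap to swap×)
open import Data.Product.Relation.Binary.Pointwise.NonDependent using (×-setoid)
open import Data.Sum.Base using (_⊎_; inj₁; inj₂)
open import Function.Base using (id; _∘_)
open import Function.Definitions using (Injective; Surjective; Congruent)
open import Relation.Binary.Bundles using (Setoid)
open import Relation.Binary.Definitions using (DecidableEquality)
open import Relation.Binary.PropositionalEquality as ≡
  using (_≡_; _≢_; module ≡-Reasoning)
import Relation.Binary.Reasoning.Setoid as ≈-Reasoning
open import Relation.Nullary using (yes; no; contradiction; recompute)

private
  variable
    r ℓr x ℓx m ℓ : Level
    a b c n : ℕ

-- Free modules on setoids

module Combinations (R : CommutativeRing r ℓr) (X : Setoid x ℓx) where
  open FreeModule R X public
  private
    module R = CommutativeRing R
    module X = Setoid X

  -- Terms are compared, and lists of terms permuted, up to equality of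
  -- coefficients and of basis elements.
  Terms : Setoid (r ⊔ x) (ℓr ⊔ ℓx)
  Terms = ×-setoid R.setoid X

  Term : Set (r ⊔ x)
  Term = Setoid.Carrier Terms

  open Permutation Terms public
    using (_↭_; refl; prep; swap; trans; ↭-refl; ↭-sym; ↭-trans; ↭-prep; ↭-swap; ↭-reflexive)
  open PermutationProperties Terms public using (shifts; ↭-split; ¬x∷xs↭[])
    renaming (++-comm to ↭-++-comm)
  module Terms = Setoid Terms

  ≋-refl : ∀ {u} → u ≋ u
  ≋-refl {[]}    = []
  ≋-refl {_ ∷ _} = cons R.refl X.refl ≋-refl

  ≋-reflexive : ∀ {u v} → u ≡ v → u ≋ v
  ≋-reflexive ≡.refl = ≋-refl

  ≋-setoid : Setoid (r ⊔ x) (r ⊔ ℓr ⊔ x ⊔ ℓx)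
  ≋-setoid = record
    { Carrier       = Combination
    ; _≈_           = _≋_
    ; isEquivalence = record { refl = ≋-refl ; sym = ≋-sym ; trans = ≋-trans }
    }

  ↭⇒≋ : ∀ {u v} → u ↭ v → u ≋ v
  ↭⇒≋ (refl [])                  = []
  ↭⇒≋ (refl ((k≈ , p≈) ∷ u≈v))   = cons k≈ p≈ (↭⇒≋ (refl u≈v))
  ↭⇒≋ (prep (k≈ , p≈) u↭v)       = cons k≈ p≈ (↭⇒≋ u↭v)
  ↭⇒≋ (swap (k≈ , p≈) (l≈ , q≈) u↭v) =
    ≋-trans (FreeModule.swap _ _ _) (cons l≈ q≈ (cons k≈ p≈ (↭⇒≋ u↭v)))
  ↭⇒≋ (trans u↭v v↭w)            = ≋-trans (↭⇒≋ u↭v) (↭⇒≋ v↭w)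

  ++-congˡ : ∀ {u u′} v → u ≋ u′ → u ++ v ≋ u′ ++ v
  ++-congˡ v []                  = ≋-refl
  ++-congˡ v (cons k≈ p≈ u≋)     = cons k≈ p≈ (++-congˡ v u≋)
  ++-congˡ v (FreeModule.swap s t u) = FreeModule.swap s t (u ++ v)
  ++-congˡ v (collect k l p u)   = collect k l p (u ++ v)
  ++-congˡ v (drop p u)          = drop p (u ++ v)
  ++-congˡ v (≋-sym u≋)          = ≋-sym (++-congˡ v u≋)
  ++-congˡ v (≋-trans u≋ ≋u)     = ≋-trans (++-congˡ v u≋) (++-congˡ v ≋u)

  ++-congʳ : ∀ u {v v′} → v ≋ v′ → u ++ v ≋ u ++ v′
  ++-congʳ []      v≋ = v≋
  ++-congʳ (_ ∷ u) v≋ = cons R.refl X.refl (++-congʳ u v≋)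

  ++-cong : ∀ {u u′ v v′} → u ≋ u′ → v ≋ v′ → u ++ v ≋ u′ ++ v′
  ++-cong {u′ = u′} u≋ v≋ = ≋-trans (++-congˡ _ u≋) (++-congʳ u′ v≋)

  -_ : Combination → Combination
  -_ = RawModule.-ᴹ_ rawModule

  module _ {s} {S : Set s} where

    map-pointwise : {F G : S → Term} → (∀ s → F s Terms.≈ G s) → ∀ u → map F u ≋ map G u
    map-pointwise F≈G []      = []
    map-pointwise F≈G (s ∷ u) = cons (proj₁ (F≈G s)) (proj₂ (F≈G s)) (map-pointwise F≈G u)

    map-+ : {f g : S → R.Carrier} {h : S → X.Carrier} → ∀ u →
            map (λ s → f s , h s) u ++ map (λ s → g s , h s) u ≋ map (λ s → f s R.+ g s , h s) u
    map-+         []      = []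
    map-+ {f} {g} {h} (s ∷ u) = begin
      (f s , h s) ∷ map _ u ++ (g s , h s) ∷ map _ u
        ≈⟨ cons R.refl X.refl (↭⇒≋ (shifts (map _ u) ((g s , h s) ∷ []))) ⟩
      (f s , h s) ∷ (g s , h s) ∷ map _ u ++ map _ u   ≈⟨ collect _ _ _ _ ⟩
      (f s R.+ g s , h s) ∷ map _ u ++ map _ u         ≈⟨ cons R.refl X.refl (map-+ u) ⟩
      (f s R.+ g s , h s) ∷ map _ u                    ∎
      where open ≈-Reasoning ≋-setoid

    map-0 : {f : S → R.Carrier} {h : S → X.Carrier} → (∀ s → f s R.≈ R.0#) → ∀ u →
            map (λ s → f s , h s) u ≋ []
    map-0 f≈0 []      = []
    map-0 f≈0 (s ∷ u) = ≋-trans (cons (f≈0 s) X.refl (map-0 f≈0 u)) (drop _ _)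

module _ (R : CommutativeRing r ℓr) where
  private
    module R = CommutativeRing R

  -- Endomorphisms of the additive group of R
  record IsAdditive (h : R.Carrier → R.Carrier) : Set (r ⊔ ℓr) where
    field
      cong   : ∀ {k l} → k R.≈ l → h k R.≈ h l
      +-homo : ∀ k l → h (k R.+ l) R.≈ h k R.+ h l
      0-homo : h R.0# R.≈ R.0#

  id-isAdditive : IsAdditive id
  id-isAdditive = record { cong = id ; +-homo = λ _ _ → R.refl ; 0-homo = R.refl }

  *ˡ-isAdditive : ∀ k → IsAdditive (k R.*_)
  *ˡ-isAdditive k = record { cong = R.*-congˡ ; +-homo = R.distribˡ k ; 0-homo = R.zeroʳ k }

  *ʳ-isAdditive : ∀ k → IsAdditive (R._* k)
  *ʳ-isAdditive k = record { cong = R.*-congʳ ; +-homo = R.distribʳ k ; 0-homo = R.zeroˡ k }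

  -‿isAdditive : IsAdditive (λ k → R.- k)
  -‿isAdditive = record
    { cong = R.-‿cong ; +-homo = λ k l → R.sym (-‿+-comm k l) ; 0-homo = -0#≈0# }
    where open RingProperties R.ring using (-0#≈0#; -‿+-comm)

  -- An additive map on coefficients and a setoid map on basis elements
  -- together induce a map of free modules.
  map-cong : ∀ {x ℓx y ℓy} (X : Setoid x ℓx) (Y : Setoid y ℓy) →
    ∀ {h g} → IsAdditive h → Congruent (Setoid._≈_ X) (Setoid._≈_ Y) g →
    ∀ {u v} → FreeModule._≋_ R X u v →
    FreeModule._≋_ R Y (map (λ (k , p) → h k , g p) u) (map (λ (k , p) → h k , g p) v)
  map-cong X Y {h} {g} additive g-cong = go
    where
    open IsAdditive additive
    module CX = Combinations R X
    module CY = Combinations R Y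
    open FreeModule
    go : ∀ {u v} → u CX.≋ v → map (λ (k , p) → h k , g p) u CY.≋ map (λ (k , p) → h k , g p) v
    go []                = []
    go (cons k≈ p≈ u≋)   = cons (cong k≈) (g-cong p≈) (go u≋)
    go (swap s t u)      = swap _ _ _
    go (collect k l p u) = ≋-trans (collect _ _ _ _) (cons (R.sym (+-homo k l)) (Setoid.refl Y) CY.≋-refl)
    go (drop p u)        = ≋-trans (cons 0-homo (Setoid.refl Y) CY.≋-refl) (drop _ _)
    go (≋-sym u≋)        = ≋-sym (go u≋)
    go (≋-trans u≋ ≋u)   = ≋-trans (go u≋) (go ≋u)

  isModule : (X : Setoid x ℓx) → let open RawModule (FreeModule.rawModule R X) in
             IsModule R _≈ᴹ_ _+ᴹ_ 0ᴹ -ᴹ_ _*ₗ_ _*ᵣ_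
  isModule X = record
    { isBimodule = record
      { isBisemimodule = record
        { +ᴹ-isCommutativeMonoid = record
          { isMonoid = record
            { isSemigroup = record
              { isMagma = record { isEquivalence = Setoid.isEquivalence ≋-setoid ; ∙-cong = ++-cong }
              ; assoc   = λ u v w → ≋-reflexive (++-assoc u v w)
              }
            ; identity = (λ _ → ≋-refl) , (λ u → ≋-reflexive (++-identityʳ u))
            }
          ; comm = λ u v → ↭⇒≋ (↭-++-comm u v)
          }
        ; isPreleftSemimodule = record
          { *ₗ-cong      = λ {k} {l} {u} {v} k≈l u≋v → ≋-trans (map-cong X X (*ˡ-isAdditive k) id u≋v)
                             (map-pointwise (λ _ → R.*-congʳ k≈l , X.refl) v)
          ; *ₗ-zeroˡ     = map-0 (λ _ → R.zeroˡ _)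
          ; *ₗ-distribʳ  = λ u k l → ≋-sym (≋-trans (map-+ u)
                             (map-pointwise (λ _ → R.sym (R.distribʳ _ k l) , X.refl) u))
          ; *ₗ-identityˡ = λ u → ≋-trans (map-pointwise (λ _ → R.*-identityˡ _ , X.refl) u)
                             (≋-reflexive (map-id u))
          ; *ₗ-assoc     = λ k l u → ≋-trans (map-pointwise (λ _ → R.*-assoc k l _ , X.refl) u)
                             (≋-reflexive (map-∘ u))
          ; *ₗ-zeroʳ     = λ _ → []
          ; *ₗ-distribˡ  = λ k u v → ≋-reflexive (map-++ _ u v)
          }
        ; isPrerightSemimodule = record
          { *ᵣ-cong      = λ {u} {v} {k} {l} u≋v k≈l → ≋-trans (map-cong X X (*ʳ-isAdditive k) id u≋v)
                             (map-pointwise (λ _ → R.*-congˡ k≈l , X.refl) v)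
          ; *ᵣ-zeroʳ     = map-0 (λ _ → R.zeroʳ _)
          ; *ᵣ-distribˡ  = λ u k l → ≋-sym (≋-trans (map-+ u)
                             (map-pointwise (λ _ → R.sym (R.distribˡ _ k l) , X.refl) u))
          ; *ᵣ-identityʳ = λ u → ≋-trans (map-pointwise (λ _ → R.*-identityʳ _ , X.refl) u)
                             (≋-reflexive (map-id u))
          ; *ᵣ-assoc     = λ u k l → ≋-trans (≋-reflexive (≡.sym (map-∘ u)))
                             (map-pointwise (λ _ → R.*-assoc _ k l , X.refl) u)
          ; *ᵣ-zeroˡ     = λ _ → []
          ; *ᵣ-distribʳ  = λ k u v → ≋-reflexive (map-++ _ u v)
          }
        ; *ₗ-*ᵣ-assoc = λ k u l → ≋-trans (≋-reflexive (≡.sym (map-∘ u)))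
            (≋-trans (map-pointwise (λ _ → R.*-assoc k _ l , X.refl) u) (≋-reflexive (map-∘ u)))
        }
      ; -ᴹ‿cong    = map-cong X X -‿isAdditive id
      ; -ᴹ‿inverse = inverseˡ , λ u → ≋-trans (↭⇒≋ (↭-++-comm u _)) (inverseˡ u)
      }
    ; *ₗ-*ᵣ-coincident = λ k → map-pointwise (λ _ → R.*-comm k _ , X.refl)
    }
    where
    open Combinations R X
    module X = Setoid X
    inverseˡ : ∀ u → (- u) ++ u ≋ []
    inverseˡ u = begin
      (- u) ++ u                      ≡⟨ ≡.cong ((- u) ++_) (map-id u) ⟨
      (- u) ++ map id u               ≈⟨ map-+ u ⟩
      map (λ (k , p) → _ , p) u       ≈⟨ map-0 (λ _ → R.-‿inverseˡ _) u ⟩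
      []                              ∎
      where open ≈-Reasoning ≋-setoid

-- Products of formal combinations

module CartesianProducts (R : CommutativeRing r ℓr) (Z : Setoid x ℓx) where
  open Combinations R Z

  private
    variable
      s : Level
      A B D E F G : Set s

  cartesianProductWith-[-]ʳ : (f : A → B → D) → ∀ u y →
    cartesianProductWith f u (y ∷ []) ≡ map (λ x → f x y) u
  cartesianProductWith-[-]ʳ f []      y = ≡.refl
  cartesianProductWith-[-]ʳ f (x ∷ u) y = ≡.cong (f x y ∷_) (cartesianProductWith-[-]ʳ f u y)

  cartesianProductWith-∷ʳ : (f : A → B → Term) → ∀ u y v →
    cartesianProductWith f u (y ∷ v) ≋ map (λ x → f x y) u ++ cartesianProductWith f u v
  cartesianProductWith-∷ʳ f []      y v = []
  cartesianProductWith-∷ʳ f (x ∷ u) y v = begin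
    f x y ∷ map (f x) v ++ cartesianProductWith f u (y ∷ v)
      ≈⟨ ++-congʳ (f x y ∷ map (f x) v) (cartesianProductWith-∷ʳ f u y v) ⟩
    f x y ∷ map (f x) v ++ map (λ x → f x y) u ++ cartesianProductWith f u v
      ≈⟨ ++-congʳ (f x y ∷ []) (↭⇒≋ (shifts (map (f x) v) (map (λ x → f x y) u))) ⟩
    f x y ∷ map (λ x → f x y) u ++ map (f x) v ++ cartesianProductWith f u v ∎
    where open ≈-Reasoning ≋-setoid

  cartesianProductWith-distribˡ-++ : (f : A → B → Term) → ∀ u v w →
    cartesianProductWith f u (v ++ w) ≋ cartesianProductWith f u v ++ cartesianProductWith f u w
  cartesianProductWith-distribˡ-++ f u []      w =
    ≋-reflexive (≡.cong (_++ cartesianProductWith f u w) (≡.sym (cartesianProductWith-zeroʳ f u)))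
  cartesianProductWith-distribˡ-++ f u (y ∷ v) w = begin
    cartesianProductWith f u (y ∷ v ++ w)
      ≈⟨ cartesianProductWith-∷ʳ f u y (v ++ w) ⟩
    fᵤy ++ cartesianProductWith f u (v ++ w)
      ≈⟨ ++-congʳ fᵤy (cartesianProductWith-distribˡ-++ f u v w) ⟩
    fᵤy ++ cartesianProductWith f u v ++ cartesianProductWith f u w
      ≡⟨ ++-assoc fᵤy _ _ ⟨
    (fᵤy ++ cartesianProductWith f u v) ++ cartesianProductWith f u w
      ≈⟨ ++-congˡ _ (cartesianProductWith-∷ʳ f u y v) ⟨
    cartesianProductWith f u (y ∷ v) ++ cartesianProductWith f u w ∎
    where
    open ≈-Reasoning ≋-setoid
    fᵤy = map (λ x → f x y) u

  map-cartesianProductWith : (f : A → B → Term) (f′ : D → E → F) (g : F → Term) (h : D → A) (h′ : E → B) →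
    (∀ x y → g (f′ x y) Terms.≈ f (h x) (h′ y)) → ∀ u v →
    map g (cartesianProductWith f′ u v) ≋ cartesianProductWith f (map h u) (map h′ v)
  map-cartesianProductWith f f′ g h h′ eq []      v = []
  map-cartesianProductWith f f′ g h h′ eq (x ∷ u) v = begin
    map g (map (f′ x) v ++ cartesianProductWith f′ u v)
      ≡⟨ map-++ g (map (f′ x) v) _ ⟩
    map g (map (f′ x) v) ++ map g (cartesianProductWith f′ u v)
      ≡⟨ ≡.cong (_++ map g (cartesianProductWith f′ u v)) (map-∘ v) ⟨
    map (g ∘ f′ x) v ++ map g (cartesianProductWith f′ u v)
      ≈⟨ ++-cong (map-pointwise (eq x) v) (map-cartesianProductWith f f′ g h h′ eq u v) ⟩
    map (f (h x) ∘ h′) v ++ cartesianProductWith f (map h u) (map h′ v)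
      ≡⟨ ≡.cong (_++ cartesianProductWith f (map h u) (map h′ v)) (map-∘ v) ⟩
    map (f (h x)) (map h′ v) ++ cartesianProductWith f (map h u) (map h′ v) ∎
    where open ≈-Reasoning ≋-setoid

  cartesianProductWith-assoc :
    (f : A → B → E) (f′ : E → D → F) (g : B → D → G) (g′ : A → G → Term) (h : F → Term) →
    (∀ x y z → h (f′ (f x y) z) Terms.≈ g′ x (g y z)) → ∀ u v w →
    map h (cartesianProductWith f′ (cartesianProductWith f u v) w) ≋
    cartesianProductWith g′ u (cartesianProductWith g v w)
  cartesianProductWith-assoc f f′ g g′ h eq []      v w = []
  cartesianProductWith-assoc f f′ g g′ h eq (x ∷ u) v w = begin
    map h (cartesianProductWith f′ (map (f x) v ++ cartesianProductWith f u v) w)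
      ≡⟨ ≡.cong (map h) (cartesianProductWith-distribʳ-++ f′ (map (f x) v) _ w) ⟩
    map h (cartesianProductWith f′ (map (f x) v) w ++ cartesianProductWith f′ (cartesianProductWith f u v) w)
      ≡⟨ map-++ h (cartesianProductWith f′ (map (f x) v) w) _ ⟩
    map h (cartesianProductWith f′ (map (f x) v) w) ++ map h (cartesianProductWith f′ (cartesianProductWith f u v) w)
      ≈⟨ ++-cong (fixed v) (cartesianProductWith-assoc f f′ g g′ h eq u v w) ⟩
    map (g′ x) (cartesianProductWith g v w) ++ cartesianProductWith g′ u (cartesianProductWith g v w) ∎
    where
    open ≈-Reasoning ≋-setoid
    fixed : ∀ v → map h (cartesianProductWith f′ (map (f x) v) w) ≋ map (g′ x) (cartesianProductWith g v w)
    fixed []      = []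
    fixed (y ∷ v) = begin
      map h (map (f′ (f x y)) w ++ cartesianProductWith f′ (map (f x) v) w)
        ≡⟨ map-++ h (map (f′ (f x y)) w) _ ⟩
      map h (map (f′ (f x y)) w) ++ map h (cartesianProductWith f′ (map (f x) v) w)
        ≡⟨ ≡.cong (_++ map h (cartesianProductWith f′ (map (f x) v) w)) (map-∘ w) ⟨
      map (h ∘ f′ (f x y)) w ++ map h (cartesianProductWith f′ (map (f x) v) w)
        ≈⟨ ++-cong (map-pointwise (eq x y) w) (fixed v) ⟩
      map (g′ x ∘ g y) w ++ map (g′ x) (cartesianProductWith g v w)
        ≡⟨ ≡.cong (_++ map (g′ x) (cartesianProductWith g v w)) (map-∘ w) ⟩
      map (g′ x) (map (g y) w) ++ map (g′ x) (cartesianProductWith g v w)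
        ≡⟨ map-++ (g′ x) (map (g y) w) _ ⟨
      map (g′ x) (map (g y) w ++ cartesianProductWith g v w) ∎

  cartesianProductWith-interchange :
    (f : A → B → E) (f′ : E → D → F) (g : A → D → G) (g′ : G → B → Term) (h : F → Term) →
    (∀ x y z → h (f′ (f x y) z) Terms.≈ g′ (g x z) y) → ∀ u v w →
    map h (cartesianProductWith f′ (cartesianProductWith f u v) w) ≋
    cartesianProductWith g′ (cartesianProductWith g u w) v
  cartesianProductWith-interchange f f′ g g′ h eq []      v w = []
  cartesianProductWith-interchange f f′ g g′ h eq (x ∷ u) v w = begin
    map h (cartesianProductWith f′ (map (f x) v ++ cartesianProductWith f u v) w)
      ≡⟨ ≡.cong (map h) (cartesianProductWith-distribʳ-++ f′ (map (f x) v) _ w) ⟩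
    map h (cartesianProductWith f′ (map (f x) v) w ++ cartesianProductWith f′ (cartesianProductWith f u v) w)
      ≡⟨ map-++ h (cartesianProductWith f′ (map (f x) v) w) _ ⟩
    map h (cartesianProductWith f′ (map (f x) v) w) ++ map h (cartesianProductWith f′ (cartesianProductWith f u v) w)
      ≈⟨ ++-cong (fixed v) (cartesianProductWith-interchange f f′ g g′ h eq u v w) ⟩
    cartesianProductWith g′ (map (g x) w) v ++ cartesianProductWith g′ (cartesianProductWith g u w) v
      ≡⟨ cartesianProductWith-distribʳ-++ g′ (map (g x) w) _ v ⟨
    cartesianProductWith g′ (map (g x) w ++ cartesianProductWith g u w) v ∎
    where
    open ≈-Reasoning ≋-setoid
    fixed : ∀ v → map h (cartesianProductWith f′ (map (f x) v) w) ≋ cartesianProductWith g′ (map (g x) w) v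
    fixed []      = ≋-reflexive (≡.sym (cartesianProductWith-zeroʳ g′ (map (g x) w)))
    fixed (y ∷ v) = begin
      map h (map (f′ (f x y)) w ++ cartesianProductWith f′ (map (f x) v) w)
        ≡⟨ map-++ h (map (f′ (f x y)) w) _ ⟩
      map h (map (f′ (f x y)) w) ++ map h (cartesianProductWith f′ (map (f x) v) w)
        ≡⟨ ≡.cong (_++ map h (cartesianProductWith f′ (map (f x) v) w)) (map-∘ w) ⟨
      map (h ∘ f′ (f x y)) w ++ map h (cartesianProductWith f′ (map (f x) v) w)
        ≈⟨ ++-cong (map-pointwise (λ z → eq x y z) w) (fixed v) ⟩
      map (λ z → g′ (g x z) y) w ++ cartesianProductWith g′ (map (g x) w) v
        ≡⟨ ≡.cong (_++ cartesianProductWith g′ (map (g x) w) v) (map-∘ w) ⟩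
      map (λ t → g′ t y) (map (g x) w) ++ cartesianProductWith g′ (map (g x) w) v
        ≈⟨ cartesianProductWith-∷ʳ g′ (map (g x) w) y v ⟨
      cartesianProductWith g′ (map (g x) w) (y ∷ v) ∎

-- The bilinear extension of a map β on basis elements
module Bilinear {x ℓx y ℓy z ℓz} (R : CommutativeRing r ℓr)
  (X : Setoid x ℓx) (Y : Setoid y ℓy) (Z : Setoid z ℓz)
  (β : Setoid.Carrier X → Setoid.Carrier Y → Setoid.Carrier Z)
  (β-cong : ∀ {p p′ q q′} → Setoid._≈_ X p p′ → Setoid._≈_ Y q q′ → Setoid._≈_ Z (β p q) (β p′ q′))
  where
  private
    module R = CommutativeRing R
    module X = Setoid X
    module Y = Setoid Y
    module Z = Setoid Z
    module CX = Combinations R X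
    module CY = Combinations R Y
    module CZ = Combinations R Z
  open CartesianProducts R Z
  open ModuleMorphisms using (IsModuleHomomorphism)
  open FreeModule using ([]; cons; swap; collect; drop; ≋-sym; ≋-trans)

  -- The product of two terms
  _·_ : CX.Term → CY.Term → CZ.Term
  (k , p) · (l , q) = k R.* l , β p q

  infixl 7 _⊗_
  _⊗_ : CX.Combination → CY.Combination → CZ.Combination
  _⊗_ = cartesianProductWith _·_

  ⊗-congʳ : ∀ u {v v′} → v CY.≋ v′ → u ⊗ v CZ.≋ u ⊗ v′
  ⊗-congʳ []            v≋ = []
  ⊗-congʳ ((k , p) ∷ u) v≋ = CZ.++-cong
    (map-cong R Y Z (*ˡ-isAdditive R k) (β-cong X.refl) v≋) (⊗-congʳ u v≋)

  ⊗-congˡ : ∀ {u u′} v → u CX.≋ u′ → u ⊗ v CZ.≋ u′ ⊗ v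
  ⊗-congˡ v []                = []
  ⊗-congˡ v (cons k≈ p≈ u≋)   = CZ.++-cong
    (CZ.map-pointwise (λ _ → R.*-congʳ k≈ , β-cong p≈ Y.refl) v) (⊗-congˡ v u≋)
  ⊗-congˡ v (swap s t u)      = CZ.↭⇒≋ (CZ.shifts (map (s ·_) v) (map (t ·_) v))
  ⊗-congˡ v (collect k l p u) = begin
    map ((k , p) ·_) v ++ map ((l , p) ·_) v ++ u ⊗ v   ≡⟨ ++-assoc (map ((k , p) ·_) v) _ _ ⟨
    (map ((k , p) ·_) v ++ map ((l , p) ·_) v) ++ u ⊗ v ≈⟨ CZ.++-congˡ (u ⊗ v) (CZ.map-+ v) ⟩
    map _ v ++ u ⊗ v
      ≈⟨ CZ.++-congˡ (u ⊗ v) (CZ.map-pointwise (λ _ → R.sym (R.distribʳ _ k l) , Z.refl) v) ⟩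
    map ((k R.+ l , p) ·_) v ++ u ⊗ v                   ∎
    where open ≈-Reasoning CZ.≋-setoid
  ⊗-congˡ v (drop p u)        = CZ.++-congˡ (u ⊗ v) (CZ.map-0 (λ _ → R.zeroˡ _) v)
  ⊗-congˡ v (≋-sym u≋)        = ≋-sym (⊗-congˡ v u≋)
  ⊗-congˡ v (≋-trans u≋ ≋u)   = ≋-trans (⊗-congˡ v u≋) (⊗-congˡ v ≋u)

  map₁-⊗ˡ : (h : R.Carrier → R.Carrier) → (∀ k l → h k R.* l R.≈ h (k R.* l)) → ∀ u v →
            map (map₁ h) u ⊗ v CZ.≋ map (map₁ h) (u ⊗ v)
  map₁-⊗ˡ h eq u v = ≋-sym (begin
    map (map₁ h) (u ⊗ v)
      ≈⟨ map-cartesianProductWith _·_ _·_ (map₁ h) (map₁ h) id (λ _ _ → R.sym (eq _ _) , Z.refl) u v ⟩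
    map (map₁ h) u ⊗ map id v
      ≡⟨ ≡.cong (map (map₁ h) u ⊗_) (map-id v) ⟩
    map (map₁ h) u ⊗ v ∎)
    where open ≈-Reasoning CZ.≋-setoid

  map₁-⊗ʳ : (h : R.Carrier → R.Carrier) → (∀ k l → k R.* h l R.≈ h (k R.* l)) → ∀ u v →
            u ⊗ map (map₁ h) v CZ.≋ map (map₁ h) (u ⊗ v)
  map₁-⊗ʳ h eq u v = ≋-sym (begin
    map (map₁ h) (u ⊗ v)
      ≈⟨ map-cartesianProductWith _·_ _·_ (map₁ h) id (map₁ h) (λ _ _ → R.sym (eq _ _) , Z.refl) u v ⟩
    map id u ⊗ map (map₁ h) v
      ≡⟨ ≡.cong (_⊗ map (map₁ h) v) (map-id u) ⟩
    u ⊗ map (map₁ h) v ∎)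
    where open ≈-Reasoning CZ.≋-setoid

  open RingProperties R.ring using (-‿distribˡ-*; -‿distribʳ-*)

  ⊗-linearˡ : ∀ v → IsModuleHomomorphism CX.rawModule CZ.rawModule (_⊗ v)
  ⊗-linearˡ v = record
    { isBimoduleHomomorphism = record
      { +ᴹ-isGroupHomomorphism = record
        { isMonoidHomomorphism = record
          { isMagmaHomomorphism = record
            { isRelHomomorphism = record { cong = ⊗-congˡ v }
            ; homo = λ u u′ → CZ.≋-reflexive (cartesianProductWith-distribʳ-++ _·_ u u′ v)
            }
          ; ε-homo = []
          }
        ; ⁻¹-homo = λ u → map₁-⊗ˡ (λ k → R.- k) (λ k l → R.sym (-‿distribˡ-* k l)) u v
        }
      ; *ₗ-homo = λ k u → map₁-⊗ˡ (k R.*_) (R.*-assoc k) u v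
      ; *ᵣ-homo = λ k u → map₁-⊗ˡ (R._* k) (λ l m → xy∙z≈xz∙y R.*-commutativeSemigroup l k m) u v
      }
    }

  ⊗-linearʳ : ∀ u → IsModuleHomomorphism CY.rawModule CZ.rawModule (u ⊗_)
  ⊗-linearʳ u = record
    { isBimoduleHomomorphism = record
      { +ᴹ-isGroupHomomorphism = record
        { isMonoidHomomorphism = record
          { isMagmaHomomorphism = record
            { isRelHomomorphism = record { cong = ⊗-congʳ u }
            ; homo = cartesianProductWith-distribˡ-++ _·_ u
            }
          ; ε-homo = CZ.≋-reflexive (cartesianProductWith-zeroʳ _·_ u)
          }
        ; ⁻¹-homo = map₁-⊗ʳ (λ k → R.- k) (λ k l → R.sym (-‿distribʳ-* k l)) u
        }
      ; *ₗ-homo = λ k → map₁-⊗ʳ (k R.*_) (λ l m → x∙yz≈y∙xz R.*-commutativeSemigroup l k m) u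
      ; *ᵣ-homo = λ k → map₁-⊗ʳ (R._* k) (λ l m → R.sym (R.*-assoc l m k)) u
      }
    }

-- The linear extension of a map g on basis elements
module Linear {x ℓx y ℓy} (R : CommutativeRing r ℓr) (X : Setoid x ℓx) (Y : Setoid y ℓy)
  (g : Setoid.Carrier X → Setoid.Carrier Y) (g-cong : Congruent (Setoid._≈_ X) (Setoid._≈_ Y) g)
  where
  private
    module R = CommutativeRing R
    module X = Setoid X
    module Y = Setoid Y
    module CX = Combinations R X
    module CY = Combinations R Y
  open ModuleMorphisms using (IsModuleHomomorphism)
  open FreeModule using ([]; cons; ≋-sym; ≋-trans)

  extend : CX.Combination → CY.Combination
  extend = map (map₂ g)

  extend-map₁ : (h : R.Carrier → R.Carrier) → ∀ u → extend (map (map₁ h) u) ≡ map (map₁ h) (extend u)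
  extend-map₁ h u = ≡.trans (≡.sym (map-∘ u)) (map-∘ u)

  extend-linear : IsModuleHomomorphism CX.rawModule CY.rawModule extend
  extend-linear = record
    { isBimoduleHomomorphism = record
      { +ᴹ-isGroupHomomorphism = record
        { isMonoidHomomorphism = record
          { isMagmaHomomorphism = record
            { isRelHomomorphism = record { cong = map-cong R X Y (id-isAdditive R) g-cong }
            ; homo = λ u v → CY.≋-reflexive (map-++ (map₂ g) u v)
            }
          ; ε-homo = []
          }
        ; ⁻¹-homo = λ u → CY.≋-reflexive (extend-map₁ (λ k → R.- k) u)
        }
      ; *ₗ-homo = λ k u → CY.≋-reflexive (extend-map₁ (k R.*_) u)
      ; *ᵣ-homo = λ k u → CY.≋-reflexive (extend-map₁ (R._* k) u)
      }
    }

-- Cancellation in free modules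

module Cancellation (R : CommutativeRing r ℓr) (X : Setoid x ℓx) where
  open Combinations R X
  private
    module R = CommutativeRing R
    module X = Setoid X

  -- Null u: the combination u can be reduced to the empty one, up to order
  -- and to equality of terms, by discarding zero terms and collecting like
  -- terms.  Every basis element in a derivation is equal to one occurring in u.
  data Null (u : Combination) : Set (r ⊔ ℓr ⊔ x ⊔ ℓx) where
    nil   : u ≡ [] → Null u
    zero  : ∀ {k p v} → u ↭ (k , p) ∷ v → k R.≈ R.0# → Null v → Null u
    merge : ∀ {k l p v} → u ↭ (k , p) ∷ (l , p) ∷ v → Null ((k R.+ l , p) ∷ v) → Null u

  ↭-[] : ∀ {u} → u ↭ [] → u ≡ []
  ↭-[] {[]}    _ = ≡.refl
  ↭-[] {_ ∷ _} p = contradiction p ¬x∷xs↭[]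

  -- Whether two permuted lists have their heads matched with each other
  ↭-∷ : ∀ s t {u v} → s ∷ u ↭ t ∷ v →
        (s Terms.≈ t × u ↭ v) ⊎ (∃ λ w → u ↭ t ∷ w × v ↭ s ∷ w)
  ↭-∷ s t {u} {v} s∷u↭t∷v with ↭-split t [] v s∷u↭t∷v
  ... | []     , w′ , s≈t ∷ u≈ , w↭v = inj₁ (s≈t , ↭-trans (refl u≈) w↭v)
  ... | s′ ∷ w , w′ , s≈s′ ∷ u≈ , w↭v = inj₂ (w ++ w′ ,
    ↭-trans (refl u≈) (shifts w (t ∷ [])) ,
    ↭-trans (↭-sym w↭v) (prep (Terms.sym s≈s′) ↭-refl))

  Null-resp-↭ : ∀ {u v} → u ↭ v → Null v → Null u
  Null-resp-↭ u↭v (nil ≡.refl)     = nil (↭-[] u↭v)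
  Null-resp-↭ u↭v (zero v↭ k≈0 N)  = zero (↭-trans u↭v v↭) k≈0 N
  Null-resp-↭ u↭v (merge v↭ N)     = merge (↭-trans u↭v v↭) N

  +-0ˡ : ∀ {k} l → k R.≈ R.0# → k R.+ l R.≈ l
  +-0ˡ l k≈0 = R.trans (R.+-congʳ k≈0) (R.+-identityˡ l)

  +-0ʳ : ∀ k {l} → l R.≈ R.0# → k R.+ l R.≈ k
  +-0ʳ k l≈0 = R.trans (R.+-congˡ l≈0) (R.+-identityʳ k)

  -- A zero term can be removed from any null combination, whichever rules
  -- its derivation applies to that term.
  zero⁻¹ : ∀ {u k p v} → Null u → u ↭ (k , p) ∷ v → k R.≈ R.0# → Null v
  zero⁻¹ (nil ≡.refl) u↭ k≈0 = contradiction (↭-sym u↭) ¬x∷xs↭[]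
  zero⁻¹ {k = k} {p} (zero {l} {q} u↭′ l≈0 N) u↭ k≈0 with ↭-∷ (l , q) (k , p) (↭-trans (↭-sym u↭′) u↭)
  ... | inj₁ (_ , w↭v)      = Null-resp-↭ (↭-sym w↭v) N
  ... | inj₂ (_ , w↭ , v↭)  = zero v↭ l≈0 (zero⁻¹ N w↭ k≈0)
  zero⁻¹ {k = k} {p} (merge {l} {m} {q} u↭′ N) u↭ k≈0 with ↭-∷ (l , q) (k , p) (↭-trans (↭-sym u↭′) u↭)
  ... | inj₁ ((l≈k , _) , w↭v) = Null-resp-↭
    (↭-trans (↭-sym w↭v) (prep (R.sym (+-0ˡ m (R.trans l≈k k≈0)) , X.refl) ↭-refl)) N
  ... | inj₂ (_ , w↭ , v↭) with ↭-∷ (m , q) (k , p) w↭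
  ...   | inj₁ ((m≈k , _) , w′↭) = Null-resp-↭
    (↭-trans v↭ (prep (R.sym (+-0ʳ l (R.trans m≈k k≈0)) , X.refl) (↭-sym w′↭))) N
  ...   | inj₂ (_ , w′↭ , w↭′) = merge (↭-trans v↭ (↭-prep _ w↭′))
    (zero⁻¹ N (↭-trans (↭-prep _ w′↭) (↭-swap _ _ ↭-refl)) k≈0)

  -- Like terms can be collected in any null combination.  The cases
  -- distinguish which of the two terms are touched by the last rule of the
  -- derivation; a rule that merges one of them with a third term is postponed
  -- until after they have been collected.
  merge⁻¹ : ∀ {u k l p q v} → Null u → u ↭ (k , p) ∷ (l , q) ∷ v → p X.≈ q → Null ((k R.+ l , p) ∷ v)
  merge⁻¹ (nil ≡.refl) u↭ p≈q = contradiction (↭-sym u↭) ¬x∷xs↭[]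
  merge⁻¹ {k = k} {l} {p} {q} (zero {m} {o} u↭′ m≈0 N) u↭ p≈q with ↭-∷ (m , o) (k , p) (↭-trans (↭-sym u↭′) u↭)
  ... | inj₁ ((m≈k , _) , w↭) = Null-resp-↭
    (↭-trans (prep (+-0ˡ l (R.trans (R.sym m≈k) m≈0) , p≈q) ↭-refl) (↭-sym w↭)) N
  ... | inj₂ (_ , w↭ , l∷v↭) with ↭-∷ (m , o) (l , q) (↭-sym l∷v↭)
  ...   | inj₁ ((m≈l , _) , w′↭v) = Null-resp-↭
    (↭-trans (prep (+-0ʳ k (R.trans (R.sym m≈l) m≈0) , X.refl) (↭-sym w′↭v)) (↭-sym w↭)) N
  ...   | inj₂ (_ , w′↭ , v↭) = zero (↭-trans (↭-prep _ v↭) (↭-swap _ _ ↭-refl)) m≈0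
    (merge⁻¹ N (↭-trans w↭ (↭-prep _ w′↭)) p≈q)
  merge⁻¹ {k = k} {l} {p} {q} (merge {m} {n} {o} u↭′ N) u↭ p≈q with ↭-∷ (m , o) (k , p) (↭-trans (↭-sym u↭′) u↭)
  ... | inj₁ ((m≈k , o≈p) , n∷w↭) with ↭-∷ (n , o) (l , q) n∷w↭
  ...   | inj₁ ((n≈l , _) , w↭v) =
    Null-resp-↭ (prep (R.+-cong (R.sym m≈k) (R.sym n≈l) , X.sym o≈p) (↭-sym w↭v)) N
  ...   | inj₂ (_ , w↭ , v↭) = merge
    (prep (R.refl , X.sym o≈p) v↭)
    (Null-resp-↭ (prep (R.trans (xy∙z≈xz∙y R.+-commutativeSemigroup k l n)
        (R.+-congʳ (R.+-congʳ (R.sym m≈k))) , X.refl) ↭-refl)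
      (merge⁻¹ N (↭-prep _ w↭) (X.trans o≈p p≈q)))
  merge⁻¹ {k = k} {l} {p} {q} (merge {m} {n} {o} u↭′ N) u↭ p≈q | inj₂ (w₀ , n∷w↭ , l∷v↭)
    with ↭-∷ (n , o) (k , p) n∷w↭ | ↭-∷ (m , o) (l , q) (↭-sym l∷v↭)
  ...   | inj₁ ((n≈k , o≈p) , w↭w₀) | inj₁ ((m≈l , _) , w₀↭v) =
    Null-resp-↭ (prep (R.trans (R.+-comm k l) (R.+-cong (R.sym m≈l) (R.sym n≈k)) , X.sym o≈p)
      (↭-sym (↭-trans w↭w₀ w₀↭v))) N
  ...   | inj₁ ((n≈k , o≈p) , w↭w₀) | inj₂ (_ , w₀↭ , v↭) = merge
    (prep (R.refl , X.sym o≈p) v↭)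
    (Null-resp-↭ (prep (R.trans (R.+-comm (k R.+ l) m)
        (R.trans (R.sym (R.+-assoc m k l)) (R.+-congʳ (R.+-congˡ (R.sym n≈k)))) , X.refl) ↭-refl)
      (merge⁻¹ N (↭-prep _ (↭-trans w↭w₀ w₀↭)) (X.trans o≈p p≈q)))
  ...   | inj₂ (_ , w↭ , w₀↭) | inj₁ ((m≈l , o≈q) , w₀↭v) = merge
    (prep (R.refl , o≈p′) (↭-trans (↭-sym w₀↭v) w₀↭))
    (Null-resp-↭ (prep (R.trans (R.+-assoc k l n)
        (R.trans (R.+-comm k (l R.+ n)) (R.+-congʳ (R.+-congʳ (R.sym m≈l)))) , X.refl) ↭-refl)
      (merge⁻¹ N (↭-prep _ w↭) (X.sym o≈p′)))
    where
    o≈p′ = X.trans p≈q (X.sym o≈q)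
  ...   | inj₂ (_ , w↭ , w₀↭) | inj₂ (_ , w₀↭′ , v↭) with ↭-∷ (n , o) (l , q) (↭-trans (↭-sym w₀↭) w₀↭′)
  ...     | inj₁ ((n≈l , o≈q) , w₁↭w₂) = merge
    (prep (R.refl , X.trans p≈q (X.sym o≈q)) (↭-trans v↭ (↭-prep _ (↭-sym w₁↭w₂))))
    (Null-resp-↭ (prep (R.trans (R.+-assoc k l m)
        (R.trans (R.+-comm k (l R.+ m)) (R.+-congʳ (R.trans (R.+-comm l m) (R.+-congˡ (R.sym n≈l))))) , X.refl) ↭-refl)
      (merge⁻¹ N (↭-prep _ w↭) (X.trans o≈q (X.sym p≈q))))
  ...     | inj₂ (_ , w₁↭ , w₂↭) = merge
    (↭-trans (↭-prep _ (↭-trans v↭ (↭-prep _ w₂↭))) (shifts ((k R.+ l , p) ∷ []) ((m , o) ∷ (n , o) ∷ [])))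
    (Null-resp-↭ (↭-swap _ _ ↭-refl)
      (merge⁻¹ N (↭-trans (↭-prep _ (↭-trans w↭ (↭-prep _ w₁↭)))
        (shifts ((m R.+ n , o) ∷ []) ((k , p) ∷ (l , q) ∷ []))) p≈q))

  -- Being null is invariant under the congruence.  The context w keeps the
  -- induction going under cons, and stating both directions makes symmetry
  -- and transitivity immediate.
  Null-resp-≋ : ∀ {u v} → u ≋ v → ∀ w → (Null (u ++ w) → Null (v ++ w)) × (Null (v ++ w) → Null (u ++ w))
  Null-resp-≋ []                               w = id , id
  Null-resp-≋ (cons {k} {l} {p} {q} {u} {v} k≈l p≈q u≋v) w with Null-resp-≋ u≋v ((k , p) ∷ w)
  ... | to , from =
    (λ N → Null-resp-↭ (↭-trans (prep (R.sym k≈l , X.sym p≈q) ↭-refl) (shifts ((k , p) ∷ []) v))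
             (to (Null-resp-↭ (shifts u ((k , p) ∷ [])) N))) ,
    (λ N → Null-resp-↭ (shifts ((k , p) ∷ []) u)
             (from (Null-resp-↭ (↭-trans (shifts v ((k , p) ∷ [])) (prep (k≈l , p≈q) ↭-refl)) N)))
  Null-resp-≋ (FreeModule.swap s t u)          w =
    Null-resp-↭ (↭-swap t s ↭-refl) , Null-resp-↭ (↭-swap s t ↭-refl)
  Null-resp-≋ (collect k l p u)                w =
    (λ N → merge⁻¹ N ↭-refl X.refl) , merge ↭-refl
  Null-resp-≋ (drop p u)                       w =
    (λ N → zero⁻¹ N ↭-refl R.refl) , zero ↭-refl R.refl
  Null-resp-≋ (≋-sym u≋v)                      w = swap× (Null-resp-≋ u≋v w)
  Null-resp-≋ (≋-trans u≋v v≋w)                z with Null-resp-≋ u≋v z | Null-resp-≋ v≋w z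
  ... | to , from | to′ , from′ = to′ ∘ to , from ∘ from′

  Null-inverse : ∀ u → Null (u ++ (- u))
  Null-inverse []            = nil ≡.refl
  Null-inverse ((k , p) ∷ u) = merge (↭-prep _ (shifts u ((R.- k , p) ∷ [])))
    (zero ↭-refl (R.-‿inverseʳ k) (Null-inverse u))

  Null⇒≋[] : ∀ {u} → Null u → u ≋ []
  Null⇒≋[] (nil ≡.refl)      = []
  Null⇒≋[] (zero u↭ k≈0 N)   = ≋-trans (↭⇒≋ u↭) (≋-trans (cons k≈0 X.refl (Null⇒≋[] N)) (drop _ _))
  Null⇒≋[] (merge u↭ N)      = ≋-trans (↭⇒≋ u↭) (≋-trans (collect _ _ _ _) (Null⇒≋[] N))

-- Injections and surjections of bases

module _ {x ℓx y ℓy} (R : CommutativeRing r ℓr) (X : Setoid x ℓx) (Y : Setoid y ℓy)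
  (g : Setoid.Carrier X → Setoid.Carrier Y) (g-cong : Congruent (Setoid._≈_ X) (Setoid._≈_ Y) g)
  where
  private
    module R = CommutativeRing R
    module X = Setoid X
    module Y = Setoid Y
    module CX = Combinations R X
    module CY = Combinations R Y
    module NX = Cancellation R X
    module NY = Cancellation R Y
  open FreeModule using ([]; cons; ≋-sym; ≋-trans)
  open Linear R X Y g g-cong using (extend; extend-linear)

  -- A term of the image of u comes from a term of u.
  extend-∷⁻¹ : ∀ {t u w} → extend u CY.↭ t ∷ w →
    ∃₂ λ s v → u CX.↭ s ∷ v × map₂ g s CY.Terms.≈ t × extend v CY.↭ w
  extend-∷⁻¹ {t} {u} {w} gu↭ with CY.↭-split t [] w gu↭
  ... | w₁ , w₂ , gu≈ , w₁w₂↭w with locate u w₁ gu≈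
    where
    locate : ∀ u w₁ {w₂} → Pointwise CY.Terms._≈_ (extend u) (w₁ ++ t ∷ w₂) →
             ∃₂ λ s v → u CX.↭ s ∷ v × map₂ g s CY.Terms.≈ t × extend v CY.↭ w₁ ++ w₂
    locate (s ∷ u) []       (e ∷ es) = s , u , CX.↭-refl , e , CY.refl es
    locate (s ∷ u) (_ ∷ w₁) (e ∷ es) with locate u w₁ es
    ... | s′ , v , u↭ , e′ , gv↭ =
      s′ , s ∷ v , CX.↭-trans (CX.↭-prep s u↭) (CX.↭-swap s s′ CX.↭-refl) , e′ , CY.prep e gv↭
  ...   | s , v , u↭ , e , gv↭ = s , v , u↭ , e , CY.↭-trans gv↭ w₁w₂↭w

  -- The derivation is copied: its basis elements all come from u, and g
  -- being injective, terms that are alike in the image are alike in u.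
  Null-reflect : Injective X._≈_ Y._≈_ g → ∀ {w u} → NY.Null w → extend u CY.↭ w → NX.Null u
  Null-reflect inj {u = []}    _               _   = NX.nil ≡.refl
  Null-reflect inj {u = _ ∷ _} (NY.nil ≡.refl) gu↭ = contradiction gu↭ CY.¬x∷xs↭[]
  Null-reflect inj {u = _ ∷ _} (NY.zero w↭ k≈0 N) gu↭ with extend-∷⁻¹ (CY.↭-trans gu↭ w↭)
  ... | _ , _ , u↭ , (l≈k , _) , gv↭ = NX.zero u↭ (R.trans l≈k k≈0) (Null-reflect inj N gv↭)
  Null-reflect inj {u = _ ∷ _} (NY.merge w↭ N) gu↭ with extend-∷⁻¹ (CY.↭-trans gu↭ w↭)
  ... | (k , p) , _ , u↭ , (k≈ , gp≈) , gv↭ with extend-∷⁻¹ gv↭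
  ...   | (l , q) , v , v↭ , (l≈ , gq≈) , gv′↭ = NX.merge
    (CX.↭-trans u↭ (CX.↭-prep _ (CX.↭-trans v↭ (CX.prep (R.refl , inj (Y.trans gq≈ (Y.sym gp≈))) CX.↭-refl))))
    (Null-reflect inj {u = (k R.+ l , p) ∷ v} N (CY.prep (R.+-cong k≈ l≈ , gp≈) gv′↭))

  extend-injective : Injective X._≈_ Y._≈_ g → Injective CX._≋_ CY._≋_ extend
  extend-injective inj {u} {v} gu≋gv = begin
    u                      ≈⟨ CX.++-congˡ u (NX.Null⇒≋[] null) ⟨
    (v ++ (CX.- u)) ++ u   ≡⟨ ++-assoc v (CX.- u) u ⟩
    v ++ (CX.- u) ++ u     ≈⟨ CX.++-congʳ v (CX.↭⇒≋ (CX.↭-++-comm (CX.- u) u)) ⟩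
    v ++ u ++ (CX.- u)     ≈⟨ CX.++-congʳ v (NX.Null⇒≋[] (NX.Null-inverse u)) ⟩
    v ++ []                ≡⟨ ++-identityʳ v ⟩
    v                      ∎
    where
    open ≈-Reasoning CX.≋-setoid
    null : NX.Null (v ++ (CX.- u))
    null = Null-reflect inj
      (proj₁ (NY.Null-resp-≋ gu≋gv (CY.- extend u)) (NY.Null-inverse (extend u)))
      (CY.↭-reflexive (≡.trans (map-++ _ v (CX.- u))
        (≡.cong (extend v ++_) (Linear.extend-map₁ R X Y g g-cong (λ k → R.- k) u))))

  extend-surjective : Surjective X._≈_ Y._≈_ g → Surjective CX._≋_ CY._≋_ extend
  extend-surjective surj v = preimage v , λ u≋ → ≋-trans (extend-cong u≋) (extend-preimage v)
    where
    open ModuleMorphisms.IsModuleHomomorphism extend-linear renaming (⟦⟧-cong to extend-cong)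
    preimage : CY.Combination → CX.Combination
    preimage = map (map₂ (λ q → proj₁ (surj q)))
    extend-preimage : ∀ v → extend (preimage v) CY.≋ v
    extend-preimage []            = []
    extend-preimage ((k , q) ∷ v) = cons R.refl (proj₂ (surj q) X.refl) (extend-preimage v)

-- Vertices and arcs of a composite

open ≡ using (refl; sym; trans; cong; subst)

-- The vertex of the composite at i corresponding to the vertex v of the outer
-- clique: vertices up to i stay in place, and the others move up by b, where
-- b + 1 is the arity of the inner clique.  The recursion shifts v only once
-- all of i is used up.
outer : (i b : ℕ) → ℕ → ℕ
outer i       b zero    = zero
outer zero    b (suc v) = suc (v + b)
outer (suc i) b (suc v) = suc (outer i b v)

outer-≤ : ∀ i b {v} → v ≤ i → outer i b v ≡ v
outer-≤ i       b z≤n       = refl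
outer-≤ (suc i) b (s≤s v≤i) = cong suc (outer-≤ i b v≤i)

outer-> : ∀ i b {v} → i < v → outer i b v ≡ v + b
outer-> zero    b {suc v} _         = refl
outer-> (suc i) b {suc v} (s≤s i<v) = cong suc (outer-> i b i<v)

outer-identity : ∀ i v → outer i 0 v ≡ v
outer-identity i       zero    = refl
outer-identity zero    (suc v) = cong suc (+-identityʳ v)
outer-identity (suc i) (suc v) = cong suc (outer-identity i v)

outer-mono-< : ∀ i b {v w} → v < w → outer i b v < outer i b w
outer-mono-< i       b {zero}  {suc w} _         = lower i
  where
  lower : ∀ i → 0 < outer i b (suc w)
  lower zero    = s≤s z≤n
  lower (suc i) = s≤s z≤n
outer-mono-< zero    b {suc v} {suc w} (s≤s v<w) = s≤s (+-monoˡ-< b v<w)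
outer-mono-< (suc i) b {suc v} {suc w} (s≤s v<w) = s≤s (outer-mono-< i b v<w)

outer-injective : ∀ i b {v w} → outer i b v ≡ outer i b w → v ≡ w
outer-injective i       b {zero}  {zero}  _ = refl
outer-injective zero    b {zero}  {suc w} ()
outer-injective (suc i) b {zero}  {suc w} ()
outer-injective zero    b {suc v} {zero}  ()
outer-injective (suc i) b {suc v} {zero}  ()
outer-injective zero    b {suc v} {suc w} eq = cong suc (+-cancelʳ-≡ b v w (suc-injective eq))
outer-injective (suc i) b {suc v} {suc w} eq = cong suc (outer-injective i b (suc-injective eq))

v≤outer : ∀ i b v → v ≤ outer i b v
v≤outer i       b zero    = z≤n
v≤outer zero    b (suc v) = s≤s (m≤m+n v b)
v≤outer (suc i) b (suc v) = s≤s (v≤outer i b v)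

outer≤v+b : ∀ i b v → outer i b v ≤ v + b
outer≤v+b i       b zero    = z≤n
outer≤v+b zero    b (suc v) = ≤-refl
outer≤v+b (suc i) b (suc v) = s≤s (outer≤v+b i b v)

i≤outer⇒i≤v : ∀ i b v → i ≤ outer i b v → i ≤ v
i≤outer⇒i≤v i b v i≤ with ≤-<-connex v i
... | inj₁ v≤i = subst (i ≤_) (outer-≤ i b v≤i) i≤
... | inj₂ i<v = <⇒≤ i<v

outer≤⇒v≤ : ∀ i b v → outer i b v ≤ suc i + b → v ≤ suc i
outer≤⇒v≤ i b v ≤i+b with ≤-<-connex v i
... | inj₁ v≤i = m≤n⇒m≤1+n v≤i
... | inj₂ i<v = +-cancelʳ-≤ b v (suc i) (subst (_≤ suc i + b) (outer-> i b i<v) ≤i+b)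

outer-series : ∀ {i j b} c → i ≤ j → j ≤ i + b → ∀ v → outer j c (outer i b v) ≡ outer i (b + c) v
outer-series {i} {j} {b} c i≤j j≤i+b v with ≤-<-connex v i
... | inj₁ v≤i = begin
  outer j c (outer i b v) ≡⟨ cong (outer j c) (outer-≤ i b v≤i) ⟩
  outer j c v             ≡⟨ outer-≤ j c (≤-trans v≤i i≤j) ⟩
  v                       ≡⟨ outer-≤ i (b + c) v≤i ⟨
  outer i (b + c) v       ∎
  where open ≡-Reasoning
... | inj₂ i<v = begin
  outer j c (outer i b v) ≡⟨ cong (outer j c) (outer-> i b i<v) ⟩
  outer j c (v + b)       ≡⟨ outer-> j c (≤-<-trans j≤i+b (+-monoˡ-< b i<v)) ⟩
  (v + b) + c             ≡⟨ +-assoc v b c ⟩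
  v + (b + c)             ≡⟨ outer-> i (b + c) i<v ⟨
  outer i (b + c) v       ∎
  where open ≡-Reasoning

outer-parallel : ∀ {i j} b c → i < j → ∀ v → outer (j + b) c (outer i b v) ≡ outer i b (outer j c v)
outer-parallel {i} {j} b c i<j v with ≤-<-connex v i | ≤-<-connex v j
... | inj₁ v≤i | _ = begin
  outer (j + b) c (outer i b v) ≡⟨ cong (outer (j + b) c) (outer-≤ i b v≤i) ⟩
  outer (j + b) c v             ≡⟨ outer-≤ (j + b) c (≤-trans v≤j (m≤m+n j b)) ⟩
  v                             ≡⟨ outer-≤ i b v≤i ⟨
  outer i b v                   ≡⟨ cong (outer i b) (outer-≤ j c v≤j) ⟨
  outer i b (outer j c v)       ∎
  where
  open ≡-Reasoning
  v≤j = ≤-trans v≤i (<⇒≤ i<j)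
... | inj₂ i<v | inj₁ v≤j = begin
  outer (j + b) c (outer i b v) ≡⟨ cong (outer (j + b) c) (outer-> i b i<v) ⟩
  outer (j + b) c (v + b)       ≡⟨ outer-≤ (j + b) c (+-monoˡ-≤ b v≤j) ⟩
  v + b                         ≡⟨ outer-> i b i<v ⟨
  outer i b v                   ≡⟨ cong (outer i b) (outer-≤ j c v≤j) ⟨
  outer i b (outer j c v)       ∎
  where open ≡-Reasoning
... | inj₂ i<v | inj₂ j<v = begin
  outer (j + b) c (outer i b v) ≡⟨ cong (outer (j + b) c) (outer-> i b i<v) ⟩
  outer (j + b) c (v + b)       ≡⟨ outer-> (j + b) c (+-monoˡ-< b j<v) ⟩
  (v + b) + c                   ≡⟨ +-swapʳ v b c ⟩
  (v + c) + b                   ≡⟨ outer-> i b (<-≤-trans i<v (m≤m+n v c)) ⟨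
  outer i b (v + c)             ≡⟨ cong (outer i b) (outer-> j c j<v) ⟨
  outer i b (outer j c v)       ∎
  where open ≡-Reasoning

outer-+ : ∀ k i b v → outer (k + i) b (k + v) ≡ k + outer i b v
outer-+ zero    i b v = refl
outer-+ (suc k) i b v = cong suc (outer-+ k i b v)

arc-≡ : {α β : Arc n} → Arc.src α ≡ Arc.src β → Arc.tgt α ≡ Arc.tgt β → α ≡ β
arc-≡ {α = arc _ _ _ _ _} {arc _ _ _ _ _} refl refl = refl

_≟ᴬ_ : DecidableEquality (Arc n)
α ≟ᴬ β with Arc.src α ≟ Arc.src β | Arc.tgt α ≟ Arc.tgt β
... | yes s | yes t = yes (arc-≡ s t)
... | no ¬s | _     = no λ eq → ¬s (cong Arc.src eq)
... | _     | no ¬t = no λ eq → ¬t (cong Arc.tgt eq)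

baseArc : Arc (suc a)
baseArc {a} = arc 1 (suc (suc a)) ≤-refl (s≤s (s≤s z≤n)) ≤-refl

edgeArc : [ n ] → Arc n
edgeArc (index i 1≤i i≤n) = arc i (suc i) 1≤i ≤-refl (s≤s i≤n)

-- The same arc with its arity rewritten, to compare cliques whose arities agree
-- only propositionally
castArc : a ≡ b → Arc (suc a) → Arc (suc b)
castArc a≡b (arc x y 1≤x x<y y≤) = arc x y 1≤x x<y (≤-trans y≤ (≤-reflexive (cong (λ n → suc (suc n)) a≡b)))

-- The embedding of the arcs of the outer clique in those of the composite
outerArc : [ suc a ] → ∀ b → Arc (suc a) → Arc (suc (a + b))
outerArc (index i _ _) b (arc x y 1≤x x<y y≤) = arc (outer i b x) (outer i b y)
  (≤-trans 1≤x (v≤outer i b x)) (outer-mono-< i b x<y)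
  (≤-trans (outer≤v+b i b y) (+-monoˡ-≤ b y≤))

-- The embedding of the arcs of the inner clique, whose vertices move up by i - 1
innerArc : [ suc a ] → Arc (suc b) → Arc (suc (a + b))
innerArc {a} {b} (index i _ i≤) (arc x y 1≤x x<y y≤) = arc (pred i + x) (pred i + y)
  (≤-trans 1≤x (m≤n+m x (pred i))) (+-monoʳ-< (pred i) x<y)
  (≤-trans (+-mono-≤ (pred-mono-≤ i≤) y≤) (≤-reflexive (trans (+-suc a (suc b)) (cong suc (+-suc a b)))))

outerArc-injective : (I : [ suc a ]) {β γ : Arc (suc a)} → outerArc I b β ≡ outerArc I b γ → β ≡ γ
outerArc-injective {b = b} I eq = arc-≡
  (outer-injective (val I) b (cong Arc.src eq)) (outer-injective (val I) b (cong Arc.tgt eq))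

innerArc-injective : (I : [ suc a ]) {β γ : Arc (suc b)} → innerArc I β ≡ innerArc I γ → β ≡ γ
innerArc-injective I eq = arc-≡
  (+-cancelˡ-≡ (pred (val I)) _ _ (cong Arc.src eq)) (+-cancelˡ-≡ (pred (val I)) _ _ (cong Arc.tgt eq))

val>0 : (I : [ n ]) → 1 ≤ val I
val>0 (index i 1≤i _) = recompute (1 ≤? i) 1≤i

val≤ : (I : [ n ]) → val I ≤ n
val≤ {n} (index i _ i≤n) = recompute (i ≤? n) i≤n

1≤src : (α : Arc n) → 1 ≤ Arc.src α
1≤src (arc x _ 1≤x _ _) = recompute (1 ≤? x) 1≤x

src<tgt : (α : Arc n) → Arc.src α < Arc.tgt α
src<tgt (arc x y _ x<y _) = recompute (x <? y) x<y

tgt≤ : (α : Arc n) → Arc.tgt α ≤ suc n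
tgt≤ {n} (arc _ y _ _ y≤) = recompute (y ≤? suc n) y≤

arc₁-unique : (α β : Arc 1) → α ≡ β
arc₁-unique α β = arc-≡ (trans (src≡1 α) (sym (src≡1 β))) (trans (tgt≡2 α) (sym (tgt≡2 β)))
  where
  src≡1 : ∀ α → Arc.src α ≡ 1
  src≡1 α = ≤-antisym (s≤s⁻¹ (≤-trans (src<tgt α) (tgt≤ α))) (1≤src α)
  tgt≡2 : ∀ α → Arc.tgt α ≡ 2
  tgt≡2 α = ≤-antisym (tgt≤ α) (≤-trans (s≤s (1≤src α)) (src<tgt α))

suc-pred-val : (I : [ n ]) → suc (pred (val I)) ≡ val I
suc-pred-val (index zero 1≤i _) = ⊥-elim-irr (1+n≰n 1≤i)
suc-pred-val (index (suc i) _ _) = refl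

outerArc-edgeArc : (I : [ suc a ]) → outerArc I b (edgeArc I) ≡ innerArc I baseArc
outerArc-edgeArc {b = b} I = arc-≡
  (begin
    outer i b i    ≡⟨ outer-≤ i b ≤-refl ⟩
    i              ≡⟨ suc-pred-val I ⟨
    suc (pred i)   ≡⟨ +-comm 1 _ ⟩
    pred i + 1     ∎)
  (begin
    outer i b (suc i)    ≡⟨ outer-> i b ≤-refl ⟩
    suc i + b            ≡⟨ cong (λ k → suc k + b) (suc-pred-val I) ⟨
    suc (suc (pred i + b)) ≡⟨ cong suc (+-suc _ b) ⟨
    suc (pred i + suc b) ≡⟨ +-suc _ (suc b) ⟨
    pred i + suc (suc b) ∎)
  where
  open ≡-Reasoning
  i = val I

-- The two embeddings only meet in the arc where the cliques are glued: a common
-- arc runs from i or above to i + 1 or below in the outer clique.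
outerArc≡innerArc⇒edgeArc : (I : [ suc a ]) (β : Arc (suc a)) (γ : Arc (suc b)) →
  outerArc I b β ≡ innerArc I γ → β ≡ edgeArc I
outerArc≡innerArc⇒edgeArc {b = b} I β γ eq = arc-≡
  (≤-antisym (s≤s⁻¹ (≤-trans (src<tgt β) y≤1+i)) i≤x)
  (≤-antisym y≤1+i (≤-trans (s≤s i≤x) (src<tgt β)))
  where
  i = val I
  i≤x : i ≤ Arc.src β
  i≤x = i≤outer⇒i≤v i b _ (begin
    i                  ≡⟨ suc-pred-val I ⟨
    suc (pred i)       ≡⟨ +-comm 1 _ ⟩
    pred i + 1         ≤⟨ +-monoʳ-≤ (pred i) (1≤src γ) ⟩
    pred i + Arc.src γ ≡⟨ cong Arc.src eq ⟨
    outer i b (Arc.src β) ∎)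
    where open ≤-Reasoning
  y≤1+i : Arc.tgt β ≤ suc i
  y≤1+i = outer≤⇒v≤ i b _ (begin
    outer i b (Arc.tgt β)  ≡⟨ cong Arc.tgt eq ⟩
    pred i + Arc.tgt γ     ≤⟨ +-monoʳ-≤ (pred i) (tgt≤ γ) ⟩
    pred i + suc (suc b)   ≡⟨ cong Arc.tgt (outerArc-edgeArc {b = b} I) ⟨
    outer i b (suc i)      ≡⟨ outer-> i b ≤-refl ⟩
    suc i + b              ∎)
    where open ≤-Reasoning

outerArc≡innerArc⇒baseArc : (I : [ suc a ]) (β : Arc (suc a)) (γ : Arc (suc b)) →
  outerArc I b β ≡ innerArc I γ → γ ≡ baseArc
outerArc≡innerArc⇒baseArc I β γ eq = innerArc-injective I (trans (sym eq)
  (trans (cong (outerArc I _) (outerArc≡innerArc⇒edgeArc I β γ eq)) (outerArc-edgeArc I)))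

outerArc-baseArc : (I : [ suc a ]) → outerArc I b baseArc ≡ baseArc
outerArc-baseArc {b = b} I = arc-≡ (outer-≤ (val I) b (val>0 I)) (outer-> (val I) b (s≤s (val≤ I)))

pred-⊕ : (I : [ suc a ]) (J : [ suc b ]) → pred (val (I ⊕ J)) ≡ pred (val I) + pred (val J)
pred-⊕ (index zero 1≤i _)    J                       = ⊥-elim-irr (1+n≰n 1≤i)
pred-⊕ I                     (index zero 1≤j _)      = ⊥-elim-irr (1+n≰n 1≤j)
pred-⊕ (index (suc i) _ _)   (index (suc j) _ _)     = cong pred (+-suc i j)

val-⊕ : (I : [ suc a ]) (J : [ suc b ]) → val (I ⊕ J) ≡ pred (val I) + val J
val-⊕ (index zero 1≤i _)    J = ⊥-elim-irr (1+n≰n 1≤i)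
val-⊕ (index (suc i) _ _)   J = refl

val-shift : ∀ b (J : [ suc a ]) → val (shift b J) ≡ val J + b
val-shift b (index j _ _) = cong pred (+-suc j b)

edgeArc-⊕ : (I : [ suc a ]) (J : [ suc b ]) → edgeArc (I ⊕ J) ≡ innerArc I (edgeArc J)
edgeArc-⊕ I J = arc-≡ (val-⊕ I J) (trans (cong suc (val-⊕ I J)) (sym (+-suc _ _)))

-- The embeddings into an iterated series composite
module _ (I : [ suc a ]) (J : [ suc b ]) (c : ℕ) where
  private
    κ : Arc (suc (a + (b + c))) → Arc (suc (a + b + c))
    κ = castArc (sym (+-assoc a b c))
    i = val I
    j = val J

  outerArc-outerArc-series : ∀ β → outerArc (I ⊕ J) c (outerArc I b β) ≡ κ (outerArc I (b + c) β)
  outerArc-outerArc-series β = arc-≡ (outer-series c i≤k k≤i+b _) (outer-series c i≤k k≤i+b _)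
    where
    open ≤-Reasoning
    i≤k : i ≤ val (I ⊕ J)
    i≤k = begin
      i            ≡⟨ suc-pred-val I ⟨
      suc (pred i) ≡⟨ +-comm 1 _ ⟩
      pred i + 1   ≤⟨ +-monoʳ-≤ (pred i) (val>0 J) ⟩
      pred i + j   ≡⟨ val-⊕ I J ⟨
      val (I ⊕ J)  ∎
    k≤i+b : val (I ⊕ J) ≤ i + b
    k≤i+b = begin
      val (I ⊕ J)      ≡⟨ val-⊕ I J ⟩
      pred i + j       ≤⟨ +-monoʳ-≤ (pred i) (val≤ J) ⟩
      pred i + suc b   ≡⟨ +-suc (pred i) b ⟩
      suc (pred i) + b ≡⟨ cong (_+ b) (suc-pred-val I) ⟩
      i + b            ∎

  outerArc-innerArc-series : ∀ γ → outerArc (I ⊕ J) c (innerArc I γ) ≡ κ (innerArc I (outerArc J c γ))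
  outerArc-innerArc-series γ = arc-≡ (vertex _) (vertex _)
    where
    vertex : ∀ v → outer (val (I ⊕ J)) c (pred i + v) ≡ pred i + outer j c v
    vertex v = trans (cong (λ k → outer k c (pred i + v)) (val-⊕ I J)) (outer-+ (pred i) j c v)

  innerArc-innerArc-series : (γ : Arc (suc c)) → innerArc (I ⊕ J) γ ≡ κ (innerArc I (innerArc J γ))
  innerArc-innerArc-series γ = arc-≡ (vertex _) (vertex _)
    where
    vertex : ∀ v → pred (val (I ⊕ J)) + v ≡ pred i + (pred j + v)
    vertex v = trans (cong (_+ v) (pred-⊕ I J)) (+-assoc (pred i) (pred j) v)

edgeArc-shift : (I J : [ suc a ]) → val I < val J → ∀ b → edgeArc (shift b J) ≡ outerArc I b (edgeArc J)
edgeArc-shift I J i<j b = arc-≡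
  (trans (val-shift b J) (sym (outer-> (val I) b i<j)))
  (trans (cong suc (val-shift b J)) (sym (outer-> (val I) b (m≤n⇒m≤1+n i<j))))

edgeArc-inject : (I J : [ suc a ]) → val I < val J → ∀ c → edgeArc (inject c I) ≡ outerArc J c (edgeArc I)
edgeArc-inject I J i<j c = arc-≡
  (sym (outer-≤ (val J) c (<⇒≤ i<j))) (sym (outer-≤ (val J) c i<j))

-- The embeddings into an iterated parallel composite
module _ (I J : [ suc a ]) (i<j : val I < val J) (b c : ℕ) where
  private
    κ : Arc (suc (a + c + b)) → Arc (suc (a + b + c))
    κ = castArc (sym (+-swapʳ a b c))
    i = val I
    j = val J

  outerArc-outerArc-parallel : ∀ β →
    outerArc (shift b J) c (outerArc I b β) ≡ κ (outerArc (inject c I) b (outerArc J c β))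
  outerArc-outerArc-parallel β = arc-≡ (vertex _) (vertex _)
    where
    vertex : ∀ v → outer (val (shift b J)) c (outer i b v) ≡ outer i b (outer j c v)
    vertex v = trans (cong (λ k → outer k c (outer i b v)) (val-shift b J)) (outer-parallel b c i<j v)

  outerArc-innerArc-parallel : (γ : Arc (suc b)) →
    outerArc (shift b J) c (innerArc I γ) ≡ κ (innerArc (inject c I) γ)
  outerArc-innerArc-parallel γ = arc-≡
    (vertex (≤-trans (<⇒≤ (src<tgt γ)) (tgt≤ γ))) (vertex (tgt≤ γ))
    where
    open ≤-Reasoning
    vertex : ∀ {v} → v ≤ suc (suc b) → outer (val (shift b J)) c (pred i + v) ≡ pred i + v
    vertex {v} v≤ = outer-≤ (val (shift b J)) c (begin
      pred i + v             ≤⟨ +-monoʳ-≤ (pred i) v≤ ⟩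
      pred i + suc (suc b)   ≡⟨ +-suc (pred i) (suc b) ⟩
      suc (pred i + suc b)   ≡⟨ cong suc (+-suc (pred i) b) ⟩
      suc (suc (pred i) + b) ≡⟨ cong (λ k → suc (k + b)) (suc-pred-val I) ⟩
      suc i + b              ≤⟨ +-monoˡ-≤ b i<j ⟩
      j + b                  ≡⟨ val-shift b J ⟨
      val (shift b J)        ∎)

  innerArc-parallel : (γ : Arc (suc c)) →
    innerArc (shift b J) γ ≡ κ (outerArc (inject c I) b (innerArc J γ))
  innerArc-parallel γ = arc-≡ (vertex (1≤src γ)) (vertex (≤-trans (1≤src γ) (<⇒≤ (src<tgt γ))))
    where
    vertex : ∀ {v} → 1 ≤ v → pred (val (shift b J)) + v ≡ outer i b (pred j + v)
    vertex {v} 1≤v = begin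
      pred (val (shift b J)) + v ≡⟨ cong (λ k → pred k + v) (val-shift b J) ⟩
      pred (j + b) + v           ≡⟨ cong (λ k → pred (k + b) + v) (suc-pred-val J) ⟨
      (pred j + b) + v           ≡⟨ +-swapʳ (pred j) b v ⟩
      (pred j + v) + b           ≡⟨ outer-> i b i<pred-j+v ⟨
      outer i b (pred j + v)     ∎
      where
      open ≡-Reasoning
      i<pred-j+v : i < pred j + v
      i<pred-j+v = ≤-trans i<j (≤-trans
        (≤-reflexive (trans (sym (suc-pred-val J)) (+-comm 1 _))) (+-monoʳ-≤ (pred j) 1≤v))

-- Composition of cliques

module Composition (M : UnitalMagma m ℓ) where
  open Cliques M
  open UnitalMagma M using (Carrier; _≈_; _∙_; ε; ∙-cong; ∙-congʳ; ∙-congˡ; identityˡ; identityʳ; setoid)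
    renaming (refl to ≈-refl; trans to ≈-trans; sym to ≈-sym; reflexive to ≈-reflexive)

  -- Where an arc α of the composite of p and q at I comes from, and its label
  data Origin (p : Clique (suc a)) (I : [ suc a ]) (q : Clique (suc b))
              (α : Arc (suc (a + b))) : Set m where
    fromOuter : ∀ β → β ≢ edgeArc I → α ≡ outerArc I b β →
                label (compose p I q) α ≡ label p β → Origin p I q α
    fromInner : ∀ γ → γ ≢ baseArc → α ≡ innerArc I γ →
                label (compose p I q) α ≡ label q γ → Origin p I q α
    fromGlue  : α ≡ innerArc I baseArc →
                label (compose p I q) α ≡ edge p I ∙ base q → Origin p I q α
    fromNeither : (∀ β → α ≢ outerArc I b β) → (∀ γ → α ≢ innerArc I γ) →
                  label (compose p I q) α ≡ ε → Origin p I q α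

  private
    m∸sb+1+b : ∀ {n} b → suc b ≤ n → n ∸ suc b + 1 + b ≡ n
    m∸sb+1+b {n} b le = trans (+-assoc (n ∸ suc b) 1 b) (m∸n+n≡m le)

    pred+∸ : ∀ {i x} → 1 ≤ i → i ≤ x → pred i + (x ∸ i + 1) ≡ x
    pred+∸ {suc i} _ i<x = trans (+-comm i _) (m∸sb+1+b i i<x)

    pred+1 : ∀ {i} → 1 ≤ i → pred i + 1 ≡ i
    pred+1 {suc i} _ = +-comm i 1

    pred+2+ : ∀ {i} b → 1 ≤ i → pred i + suc (suc b) ≡ i + suc b
    pred+2+ {suc i} b _ = +-suc i (suc b)

  origin : (p : Clique (suc a)) (I : [ suc a ]) (q : Clique (suc b)) → ∀ α → Origin p I q α
  origin {a} {b} p I@(index i _ _) q α@(arc x y _ _ _) with position i (suc b) x y in eq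
  ... | before y≤i′ = fromOuter (arc x y _ _ _)
        (λ e → 1+n≰n (subst (_≤ i) (cong Arc.tgt e) y≤i))
        (arc-≡ (sym (outer-≤ i b (≤-trans (<⇒≤ (src<tgt α)) y≤i))) (sym (outer-≤ i b y≤i)))
        (cong (labelAt p I q α) eq)
    where
    y≤i : y ≤ i
    y≤i = recompute (y ≤? i) y≤i′
  ... | above x≤i′ i+m≤y′ ¬glued = fromOuter (arc x (y ∸ suc b + 1) _ _ _)
        (λ e → ⊥-elim-irr (¬glued (cong Arc.src e ,
          trans (sym y-shift) (trans (cong (_+ b) (cong Arc.tgt e)) (sym (+-suc i b))))))
        (arc-≡ (sym (outer-≤ i b x≤i)) (sym (trans (outer-> i b i<) y-shift)))
        (cong (labelAt p I q α) eq)
    where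
    x≤i : x ≤ i
    x≤i = recompute (x ≤? i) x≤i′
    i+m≤y : i + suc b ≤ y
    i+m≤y = recompute (i + suc b ≤? y) i+m≤y′
    i< : i < y ∸ suc b + 1
    i< = ≤-trans (s≤s (m+n≤o⇒m≤o∸n i i+m≤y)) (≤-reflexive (+-comm 1 _))
    y-shift : y ∸ suc b + 1 + b ≡ y
    y-shift = m∸sb+1+b b (≤-trans (m≤n+m _ i) i+m≤y)
  ... | after i+m≤x′ = fromOuter (arc (x ∸ suc b + 1) (y ∸ suc b + 1) _ _ _)
        (λ e → <-irrefl (sym (cong Arc.src e)) (i< i+m≤x))
        (arc-≡ (sym (shifted i+m≤x)) (sym (shifted (≤-trans i+m≤x (<⇒≤ (src<tgt α))))))
        (cong (labelAt p I q α) eq)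
    where
    i+m≤x : i + suc b ≤ x
    i+m≤x = recompute (i + suc b ≤? x) i+m≤x′
    i< : ∀ {v} → i + suc b ≤ v → i < v ∸ suc b + 1
    i< i+m≤v = ≤-trans (s≤s (m+n≤o⇒m≤o∸n i i+m≤v)) (≤-reflexive (+-comm 1 _))
    shifted : ∀ {v} → i + suc b ≤ v → outer i b (v ∸ suc b + 1) ≡ v
    shifted i+m≤v = trans (outer-> i b (i< i+m≤v)) (m∸sb+1+b b (≤-trans (m≤n+m _ i) i+m≤v))
  ... | inside i≤x′ _ ¬glued = fromInner (arc (x ∸ i + 1) (y ∸ i + 1) _ _ _)
        (λ e → ⊥-elim-irr (¬glued
          ( trans (sym x-shift) (trans (cong (pred i +_) (cong Arc.src e)) (pred+1 (val>0 I)))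
          , trans (sym y-shift) (trans (cong (pred i +_) (cong Arc.tgt e)) (pred+2+ b (val>0 I))))))
        (arc-≡ (sym x-shift) (sym y-shift))
        (cong (labelAt p I q α) eq)
    where
    i≤x : i ≤ x
    i≤x = recompute (i ≤? x) i≤x′
    x-shift : pred i + (x ∸ i + 1) ≡ x
    x-shift = pred+∸ (val>0 I) i≤x
    y-shift : pred i + (y ∸ i + 1) ≡ y
    y-shift = pred+∸ (val>0 I) (≤-trans i≤x (<⇒≤ (src<tgt α)))
  ... | glued g = fromGlue
        (arc-≡ (trans (recompute (x ≟ i) (proj₁ g)) (sym (pred+1 (val>0 I))))
               (trans (recompute (y ≟ i + suc b) (proj₂ g)) (sym (pred+2+ b (val>0 I)))))
        (cong (labelAt p I q α) eq)
  ... | crossing ¬before ¬above ¬after ¬inside _ = fromNeither ¬outer ¬inner (cong (labelAt p I q α) eq)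
    where
    right : ∀ {v} → i < v → i + suc b ≤ outer i b v
    right {v} i<v = begin
      i + suc b   ≡⟨ +-suc i b ⟩
      suc i + b   ≤⟨ +-monoˡ-≤ b i<v ⟩
      v + b       ≡⟨ outer-> i b i<v ⟨
      outer i b v ∎
      where open ≤-Reasoning
    ¬outer : ∀ β → α ≢ outerArc I b β
    ¬outer β refl with ≤-<-connex (Arc.src β) i | ≤-<-connex (Arc.tgt β) i
    ... | _        | inj₁ v≤i = ⊥-elim-irr (¬before (≤-trans (≤-reflexive (outer-≤ i b v≤i)) v≤i))
    ... | inj₁ u≤i | inj₂ i<v = ⊥-elim-irr (¬above (≤-trans (≤-reflexive (outer-≤ i b u≤i)) u≤i , right i<v))
    ... | inj₂ i<u | inj₂ _   = ⊥-elim-irr (¬after (right i<u))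
    ¬inner : ∀ γ → α ≢ innerArc I γ
    ¬inner γ refl = ⊥-elim-irr (¬inside
      ( ≤-trans (≤-reflexive (sym (pred+1 (val>0 I)))) (+-monoʳ-≤ (pred i) (1≤src γ))
      , ≤-trans (+-monoʳ-≤ (pred i) (tgt≤ γ)) (≤-reflexive (pred+2+ b (val>0 I)))))

  label-outerArc : (p : Clique (suc a)) (I : [ suc a ]) (q : Clique (suc b)) → ∀ {β} → β ≢ edgeArc I →
                   label (compose p I q) (outerArc I b β) ≡ label p β
  label-outerArc {b = b} p I q {β} β≢ with origin p I q (outerArc I b β)
  ... | fromOuter β′ _ eq l with refl ← outerArc-injective {b = b} I {β} {β′} eq = l
  ... | fromInner γ _ eq _  = ⊥-elim (β≢ (outerArc≡innerArc⇒edgeArc I β γ eq))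
  ... | fromGlue eq _       = ⊥-elim (β≢ (outerArc≡innerArc⇒edgeArc I β baseArc eq))
  ... | fromNeither ¬outer _ _ = ⊥-elim (¬outer β refl)

  label-innerArc : (p : Clique (suc a)) (I : [ suc a ]) (q : Clique (suc b)) → ∀ {γ} → γ ≢ baseArc →
                   label (compose p I q) (innerArc I γ) ≡ label q γ
  label-innerArc {a} p I q {γ} γ≢ with origin p I q (innerArc I γ)
  ... | fromOuter β _ eq _  = ⊥-elim (γ≢ (outerArc≡innerArc⇒baseArc I β γ (sym eq)))
  ... | fromInner γ′ _ eq l with refl ← innerArc-injective {a} I {γ} {γ′} eq = l
  ... | fromGlue eq _       = ⊥-elim (γ≢ (innerArc-injective I eq))
  ... | fromNeither _ ¬inner _ = ⊥-elim (¬inner γ refl)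

  label-glue : (p : Clique (suc a)) (I : [ suc a ]) (q : Clique (suc b)) →
               label (compose p I q) (innerArc I baseArc) ≡ edge p I ∙ base q
  label-glue p I q with origin p I q (innerArc I baseArc)
  ... | fromOuter β β≢ eq _ = ⊥-elim (β≢ (outerArc≡innerArc⇒edgeArc I β baseArc (sym eq)))
  ... | fromInner γ γ≢ eq _ = ⊥-elim (γ≢ (sym (innerArc-injective I eq)))
  ... | fromGlue _ l        = l
  ... | fromNeither _ ¬inner _ = ⊥-elim (¬inner baseArc refl)

  label-crossing : (p : Clique (suc a)) (I : [ suc a ]) (q : Clique (suc b)) → ∀ {α} →
                   (∀ β → α ≢ outerArc I b β) → (∀ γ → α ≢ innerArc I γ) →
                   label (compose p I q) α ≡ ε
  label-crossing p I q {α} ¬outer ¬inner with origin p I q α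
  ... | fromOuter β _ eq _ = ⊥-elim (¬outer β eq)
  ... | fromInner γ _ eq _ = ⊥-elim (¬inner γ eq)
  ... | fromGlue eq _      = ⊥-elim (¬inner baseArc eq)
  ... | fromNeither _ _ l   = l

  -- The transport of cliques underlying the cast of combinations
  castClique : a ≡ b → Clique (suc a) → Clique (suc b)
  castClique a≡b = subst (λ n → Clique (suc n)) a≡b

  label-castClique : (a≡b : a ≡ b) (p : Clique (suc a)) → ∀ α →
                     label (castClique a≡b p) α ≡ label p (castArc (sym a≡b) α)
  label-castClique refl p α = cong (label p) (arc-≡ refl refl)

  module _ (p : Clique (suc a)) (q : Clique (suc b)) (r : Clique (suc c)) (I : [ suc a ]) (J : [ suc b ]) where
    private
      κ : Arc (suc (a + (b + c))) → Arc (suc (a + b + c))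
      κ = castArc (sym (+-assoc a b c))
      κ-injective : ∀ {α β} → κ α ≡ κ β → α ≡ β
      κ-injective eq = arc-≡ (cong Arc.src eq) (cong Arc.tgt eq)
      p∘q = compose p I q
      q∘r = compose q J r
      lhs = compose p∘q (I ⊕ J) r
      rhs = compose p I q∘r

    -- An arc that comes from none of p, q and r
    crossing-series : ∀ {α} →
      (∀ β → α ≢ outerArc I (b + c) β) →
      (∀ γ → α ≢ innerArc I (outerArc J c γ)) →
      (∀ δ → α ≢ innerArc I (innerArc J δ)) →
      label lhs (κ α) ≡ ε
    crossing-series {α} ¬p ¬q ¬r = outermost (origin p∘q (I ⊕ J) r (κ α))
      where
      nested : ∀ {β} → κ α ≡ outerArc (I ⊕ J) c β → Origin p I q β → label p∘q β ≡ ε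
      nested eq (fromOuter γ _ refl _) = ⊥-elim (¬p γ (κ-injective (trans eq (outerArc-outerArc-series I J c γ))))
      nested eq (fromInner γ _ refl _) = ⊥-elim (¬q γ (κ-injective (trans eq (outerArc-innerArc-series I J c γ))))
      nested eq (fromGlue refl _)      = ⊥-elim (¬q baseArc
        (κ-injective (trans eq (outerArc-innerArc-series I J c baseArc))))
      nested _  (fromNeither _ _ l)     = l

      outermost : Origin p∘q (I ⊕ J) r (κ α) → label lhs (κ α) ≡ ε
      outermost (fromNeither _ _ l)   = l
      outermost (fromInner δ _ eq _) = ⊥-elim (¬r δ (κ-injective (trans eq (innerArc-innerArc-series I J c δ))))
      outermost (fromGlue eq _)      = ⊥-elim (¬r baseArc (κ-injective (trans eq (innerArc-innerArc-series I J c baseArc))))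
      outermost (fromOuter β _ eq l) = trans l (nested eq (origin p I q β))

    label-outer-series : ∀ {β} → β ≢ edgeArc I → label lhs (κ (outerArc I (b + c) β)) ≡ label p β
    label-outer-series {β} β≢ = begin
      label lhs (κ (outerArc I (b + c) β))
        ≡⟨ cong (label lhs) (outerArc-outerArc-series I J c β) ⟨
      label lhs (outerArc (I ⊕ J) c (outerArc I b β))
        ≡⟨ label-outerArc p∘q (I ⊕ J) r (λ eq → β≢
             (outerArc≡innerArc⇒edgeArc I β (edgeArc J) (trans eq (edgeArc-⊕ I J)))) ⟩
      label p∘q (outerArc I b β)
        ≡⟨ label-outerArc p I q β≢ ⟩
      label p β ∎
      where open ≡-Reasoning

    label-inner-series : ∀ {β} → β ≢ baseArc → Origin q J r β → label lhs (κ (innerArc I β)) ≡ label q∘r β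
    label-inner-series {β} β≢ (fromNeither ¬outer ¬inner l) = trans
      (crossing-series
        (λ γ eq → β≢ (outerArc≡innerArc⇒baseArc I γ β (sym eq)))
        (λ γ eq → ¬outer γ (innerArc-injective I eq))
        (λ δ eq → ¬inner δ (innerArc-injective I eq)))
      (sym l)
    label-inner-series β≢ (fromOuter γ γ≢ refl l) = begin
      label lhs (κ (innerArc I (outerArc J c γ)))
        ≡⟨ cong (label lhs) (outerArc-innerArc-series I J c γ) ⟨
      label lhs (outerArc (I ⊕ J) c (innerArc I γ))
        ≡⟨ label-outerArc p∘q (I ⊕ J) r (λ eq → γ≢ (innerArc-injective I (trans eq (edgeArc-⊕ I J)))) ⟩
      label p∘q (innerArc I γ)
        ≡⟨ label-innerArc p I q (λ eq → β≢ (trans (cong (outerArc J c) eq) (outerArc-baseArc J))) ⟩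
      label q γ
        ≡⟨ l ⟨
      label q∘r (outerArc J c γ) ∎
      where open ≡-Reasoning
    label-inner-series β≢ (fromInner δ δ≢ refl l) = begin
      label lhs (κ (innerArc I (innerArc J δ)))
        ≡⟨ cong (label lhs) (innerArc-innerArc-series I J c δ) ⟨
      label lhs (innerArc (I ⊕ J) δ)
        ≡⟨ label-innerArc p∘q (I ⊕ J) r δ≢ ⟩
      label r δ
        ≡⟨ l ⟨
      label q∘r (innerArc J δ) ∎
      where open ≡-Reasoning
    label-inner-series β≢ (fromGlue refl l) = begin
      label lhs (κ (innerArc I (innerArc J baseArc)))
        ≡⟨ cong (label lhs) (innerArc-innerArc-series I J c baseArc) ⟨
      label lhs (innerArc (I ⊕ J) baseArc)
        ≡⟨ label-glue p∘q (I ⊕ J) r ⟩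
      label p∘q (edgeArc (I ⊕ J)) ∙ base r
        ≡⟨ cong (λ α → label p∘q α ∙ base r) (edgeArc-⊕ I J) ⟩
      label p∘q (innerArc I (edgeArc J)) ∙ base r
        ≡⟨ cong (_∙ base r) (label-innerArc p I q λ eq → β≢
             (trans (sym (outerArc-edgeArc J)) (trans (cong (outerArc J c) eq) (outerArc-baseArc J)))) ⟩
      edge q J ∙ base r
        ≡⟨ l ⟨
      label q∘r (innerArc J baseArc) ∎
      where open ≡-Reasoning

    -- The arc where p is glued to the composite of q and r.  If the base of q is its J-th edge,
    -- then q has arity 1 and all three cliques meet in this arc; otherwise only
    -- p and q do.
    label-glue-series : label lhs (κ (innerArc I baseArc)) ≈ edge p I ∙ base q∘r
    label-glue-series with edgeArc J ≟ᴬ baseArc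
    ... | no e≢base = ≈-reflexive (begin
      label lhs (κ (innerArc I baseArc))
        ≡⟨ cong (label lhs ∘ κ ∘ innerArc I) (outerArc-baseArc J) ⟨
      label lhs (κ (innerArc I (outerArc J c baseArc)))
        ≡⟨ cong (label lhs) (outerArc-innerArc-series I J c baseArc) ⟨
      label lhs (outerArc (I ⊕ J) c (innerArc I baseArc))
        ≡⟨ label-outerArc p∘q (I ⊕ J) r (λ eq → e≢base
             (sym (innerArc-injective I (trans eq (edgeArc-⊕ I J))))) ⟩
      label p∘q (innerArc I baseArc)
        ≡⟨ label-glue p I q ⟩
      edge p I ∙ base q
        ≡⟨ cong (edge p I ∙_) (label-outerArc q J r (e≢base ∘ sym)) ⟨
      edge p I ∙ label q∘r (outerArc J c baseArc)
        ≡⟨ cong (λ α → edge p I ∙ label q∘r α) (outerArc-baseArc J) ⟩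
      edge p I ∙ base q∘r ∎)
      where open ≡-Reasoning
    ... | yes e≡base = begin
      label lhs (κ (innerArc I baseArc))
        ≡⟨ cong (label lhs ∘ κ ∘ innerArc I) base≡ ⟨
      label lhs (κ (innerArc I (innerArc J baseArc)))
        ≡⟨ cong (label lhs) (innerArc-innerArc-series I J c baseArc) ⟨
      label lhs (innerArc (I ⊕ J) baseArc)
        ≡⟨ label-glue p∘q (I ⊕ J) r ⟩
      label p∘q (edgeArc (I ⊕ J)) ∙ base r
        ≡⟨ cong (λ α → label p∘q α ∙ base r) (trans (edgeArc-⊕ I J) (cong (innerArc I) e≡base)) ⟩
      label p∘q (innerArc I baseArc) ∙ base r
        ≡⟨ cong (_∙ base r) (label-glue p I q) ⟩
      (edge p I ∙ base q) ∙ base r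
        ≈⟨ ∙-congʳ (≈-trans (∙-congˡ (trivial q b≡0 _)) (identityʳ _)) ⟩
      edge p I ∙ base r
        ≈⟨ ∙-congˡ (≈-trans (∙-congʳ (trivial q b≡0 _)) (identityˡ _)) ⟨
      edge p I ∙ (edge q J ∙ base r)
        ≡⟨ cong (edge p I ∙_) (label-glue q J r) ⟨
      edge p I ∙ label q∘r (innerArc J baseArc)
        ≡⟨ cong (λ α → edge p I ∙ label q∘r α) base≡ ⟩
      edge p I ∙ base q∘r ∎
      where
      open ≈-Reasoning setoid
      b≡0 : suc b ≡ 1
      b≡0 = trans (suc-injective (sym (cong Arc.tgt e≡base))) (cong Arc.src e≡base)
      base≡ : innerArc J baseArc ≡ baseArc
      base≡ = trans (sym (outerArc-edgeArc J)) (trans (cong (outerArc J c) e≡base) (outerArc-baseArc J))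

    label-series : ∀ α → label lhs (κ α) ≈ label rhs α
    label-series α = outermost (origin p I q∘r α)
      where
      outermost : ∀ {α} → Origin p I q∘r α → label lhs (κ α) ≈ label rhs α
      outermost (fromNeither ¬outer ¬inner l) = ≈-reflexive (trans
        (crossing-series ¬outer (¬inner ∘ outerArc J c) (¬inner ∘ innerArc J)) (sym l))
      outermost (fromOuter β β≢ refl l) = ≈-reflexive (trans (label-outer-series β≢) (sym l))
      outermost (fromInner β β≢ refl l) = ≈-reflexive (trans (label-inner-series β≢ (origin q J r β)) (sym l))
      outermost (fromGlue refl l)       = ≈-trans label-glue-series (≈-reflexive (sym l))

  series-clique : (p : Clique (suc a)) (q : Clique (suc b)) (r : Clique (suc c)) (I : [ suc a ]) (J : [ suc b ]) →
    ∀ α → label (castClique (+-assoc a b c) (compose (compose p I q) (I ⊕ J) r)) α ≈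
          label (compose p I (compose q J r)) α
  series-clique {a} {b} {c} p q r I J α = ≈-trans
    (≈-reflexive (label-castClique (+-assoc a b c) _ α)) (label-series p q r I J α)

  module _ (p : Clique (suc a)) (q : Clique (suc b)) (r : Clique (suc c)) (I J : [ suc a ])
           (i<j : val I < val J) where
    private
      κ : Arc (suc (a + c + b)) → Arc (suc (a + b + c))
      κ = castArc (sym (+-swapʳ a b c))
      κ-injective : ∀ {α β} → κ α ≡ κ β → α ≡ β
      κ-injective eq = arc-≡ (cong Arc.src eq) (cong Arc.tgt eq)
      J′ = shift b J
      I′ = inject c I
      p∘q = compose p I q
      p∘r = compose p J r
      lhs = compose p∘q J′ r
      rhs = compose p∘r I′ q

      e≢e : edgeArc J ≢ edgeArc I
      e≢e eq = <-irrefl (sym (cong Arc.src eq)) i<j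

    -- An arc that comes from none of p, q and r
    crossing-parallel : ∀ {α} →
      (∀ γ → α ≢ outerArc I′ b (outerArc J c γ)) →
      (∀ γ → α ≢ innerArc I′ γ) →
      (∀ δ → α ≢ outerArc I′ b (innerArc J δ)) →
      label lhs (κ α) ≡ ε
    crossing-parallel {α} ¬p ¬q ¬r = outermost (origin p∘q J′ r (κ α))
      where
      nested : ∀ {β} → κ α ≡ outerArc J′ c β → Origin p I q β → label p∘q β ≡ ε
      nested eq (fromOuter γ _ refl _) = ⊥-elim (¬p γ (κ-injective (trans eq (outerArc-outerArc-parallel I J i<j b c γ))))
      nested eq (fromInner γ _ refl _) = ⊥-elim (¬q γ (κ-injective (trans eq (outerArc-innerArc-parallel I J i<j b c γ))))
      nested eq (fromGlue refl _)      = ⊥-elim (¬q baseArc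
        (κ-injective (trans eq (outerArc-innerArc-parallel I J i<j b c baseArc))))
      nested _  (fromNeither _ _ l)     = l

      outermost : Origin p∘q J′ r (κ α) → label lhs (κ α) ≡ ε
      outermost (fromNeither _ _ l)   = l
      outermost (fromInner δ _ eq _) = ⊥-elim (¬r δ (κ-injective (trans eq (innerArc-parallel I J i<j b c δ))))
      outermost (fromGlue eq _)      = ⊥-elim (¬r baseArc (κ-injective (trans eq (innerArc-parallel I J i<j b c baseArc))))
      outermost (fromOuter β _ eq l) = trans l (nested eq (origin p I q β))

    label-outer-parallel : ∀ {β} → β ≢ edgeArc I′ → Origin p J r β →
                           label lhs (κ (outerArc I′ b β)) ≡ label p∘r β
    label-outer-parallel {β} β≢ (fromNeither ¬outer ¬inner l) = trans
      (crossing-parallel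
        (λ γ eq → ¬outer γ (outerArc-injective I′ eq))
        (λ γ eq → β≢ (outerArc≡innerArc⇒edgeArc I′ β γ eq))
        (λ δ eq → ¬inner δ (outerArc-injective I′ eq)))
      (sym l)
    label-outer-parallel β≢ (fromOuter γ γ≢ refl l) = begin
      label lhs (κ (outerArc I′ b (outerArc J c γ)))
        ≡⟨ cong (label lhs) (outerArc-outerArc-parallel I J i<j b c γ) ⟨
      label lhs (outerArc J′ c (outerArc I b γ))
        ≡⟨ label-outerArc p∘q J′ r (λ eq → γ≢
             (outerArc-injective I (trans eq (edgeArc-shift I J i<j b)))) ⟩
      label p∘q (outerArc I b γ)
        ≡⟨ label-outerArc p I q (λ eq → β≢
             (trans (cong (outerArc J c) eq) (sym (edgeArc-inject I J i<j c)))) ⟩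
      label p γ
        ≡⟨ l ⟨
      label p∘r (outerArc J c γ) ∎
      where open ≡-Reasoning
    label-outer-parallel β≢ (fromInner δ δ≢ refl l) = begin
      label lhs (κ (outerArc I′ b (innerArc J δ)))
        ≡⟨ cong (label lhs) (innerArc-parallel I J i<j b c δ) ⟨
      label lhs (innerArc J′ δ)
        ≡⟨ label-innerArc p∘q J′ r δ≢ ⟩
      label r δ
        ≡⟨ l ⟨
      label p∘r (innerArc J δ) ∎
      where open ≡-Reasoning
    label-outer-parallel β≢ (fromGlue refl l) = begin
      label lhs (κ (outerArc I′ b (innerArc J baseArc)))
        ≡⟨ cong (label lhs) (innerArc-parallel I J i<j b c baseArc) ⟨
      label lhs (innerArc J′ baseArc)
        ≡⟨ label-glue p∘q J′ r ⟩
      label p∘q (edgeArc J′) ∙ base r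
        ≡⟨ cong (λ α → label p∘q α ∙ base r) (edgeArc-shift I J i<j b) ⟩
      label p∘q (outerArc I b (edgeArc J)) ∙ base r
        ≡⟨ cong (_∙ base r) (label-outerArc p I q e≢e) ⟩
      edge p J ∙ base r
        ≡⟨ l ⟨
      label p∘r (innerArc J baseArc) ∎
      where open ≡-Reasoning

    label-inner-parallel : ∀ γ → label lhs (κ (innerArc I′ γ)) ≡ label p∘q (innerArc I γ)
    label-inner-parallel γ = begin
      label lhs (κ (innerArc I′ γ))
        ≡⟨ cong (label lhs) (outerArc-innerArc-parallel I J i<j b c γ) ⟨
      label lhs (outerArc J′ c (innerArc I γ))
        ≡⟨ label-outerArc p∘q J′ r (λ eq → e≢e (outerArc≡innerArc⇒edgeArc I (edgeArc J) γ
             (sym (trans eq (edgeArc-shift I J i<j b))))) ⟩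
      label p∘q (innerArc I γ) ∎
      where open ≡-Reasoning

    label-parallel : ∀ α → label lhs (κ α) ≡ label rhs α
    label-parallel α = outermost (origin p∘r I′ q α)
      where
      outermost : ∀ {α} → Origin p∘r I′ q α → label lhs (κ α) ≡ label rhs α
      outermost (fromNeither ¬outer ¬inner l) = trans
        (crossing-parallel (¬outer ∘ outerArc J c) ¬inner (¬outer ∘ innerArc J)) (sym l)
      outermost (fromOuter β β≢ refl l) = trans (label-outer-parallel β≢ (origin p J r β)) (sym l)
      outermost (fromInner γ γ≢ refl l) = trans (label-inner-parallel γ)
        (trans (label-innerArc p I q γ≢) (sym l))
      outermost (fromGlue refl l) = begin
        label lhs (κ (innerArc I′ baseArc))   ≡⟨ label-inner-parallel baseArc ⟩
        label p∘q (innerArc I baseArc)        ≡⟨ label-glue p I q ⟩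
        edge p I ∙ base q                     ≡⟨ cong (_∙ base q) (label-outerArc p J r (e≢e ∘ sym)) ⟨
        label p∘r (outerArc J c (edgeArc I)) ∙ base q
          ≡⟨ cong (λ α → label p∘r α ∙ base q) (edgeArc-inject I J i<j c) ⟨
        edge p∘r I′ ∙ base q                  ≡⟨ l ⟨
        label rhs (innerArc I′ baseArc)       ∎
        where open ≡-Reasoning

  parallel-clique : (p : Clique (suc a)) (q : Clique (suc b)) (r : Clique (suc c)) (I J : [ suc a ]) →
    val I < val J →
    ∀ α → label (castClique (+-swapʳ a b c) (compose (compose p I q) (shift b J) r)) α ≈
          label (compose (compose p J r) (inject c I) q) α
  parallel-clique {a} {b} {c} p q r I J i<j α = ≈-reflexive (trans
    (label-castClique (+-swapʳ a b c) _ α) (label-parallel p q r I J i<j α))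

  unitˡ-clique : (p : Clique (suc a)) → ∀ α → label (compose 𝐮 first p) α ≈ label p α
  unitˡ-clique p α = go α (origin 𝐮 first p α)
    where
    go : ∀ α → Origin 𝐮 first p α → label (compose 𝐮 first p) α ≈ label p α
    go _ (fromOuter β β≢ _ _)     = ⊥-elim (β≢ (arc₁-unique β _))
    go _ (fromInner γ _ refl l)   = ≈-reflexive l
    go _ (fromGlue refl l)        = ≈-trans (≈-reflexive l) (identityˡ _)
    go α (fromNeither _ ¬inner _)  = ⊥-elim (¬inner α refl)

  unitʳ-clique : (p : Clique (suc a)) (I : [ suc a ]) →
    ∀ α → label (castClique (+-identityʳ a) (compose p I 𝐮)) α ≈ label p α
  unitʳ-clique {a} p I α = ≈-trans (≈-reflexive (label-castClique (+-identityʳ a) _ α)) (go α (origin p I 𝐮 (κ α)))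
    where
    κ : Arc (suc a) → Arc (suc (a + 0))
    κ = castArc (sym (+-identityʳ a))
    outerArc-𝐮 : ∀ α → κ α ≡ outerArc I 0 α
    outerArc-𝐮 α = arc-≡ (sym (outer-identity (val I) _)) (sym (outer-identity (val I) _))
    go : ∀ α → Origin p I 𝐮 (κ α) → label (compose p I 𝐮) (κ α) ≈ label p α
    go α (fromOuter β _ eq l)    = ≈-reflexive (trans l (cong (label p)
      (outerArc-injective {b = 0} I (trans (sym eq) (outerArc-𝐮 α)))))
    go α (fromInner γ γ≢ _ _)    = ⊥-elim (γ≢ (arc₁-unique γ _))
    go α (fromGlue eq l)         = ≈-trans (≈-reflexive l) (≈-trans (identityʳ _)
      (≈-reflexive (cong (label p) (outerArc-injective {b = 0} I
        (trans (outerArc-edgeArc I) (trans (sym eq) (outerArc-𝐮 α)))))))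
    go α (fromNeither ¬outer _ _) = ⊥-elim (¬outer α (outerArc-𝐮 α))

  compose-cong : {p p′ : Clique (suc a)} (I : [ suc a ]) {q q′ : Clique (suc b)} →
    (∀ β → label p β ≈ label p′ β) → (∀ γ → label q γ ≈ label q′ γ) →
    ∀ α → label (compose p I q) α ≈ label (compose p′ I q′) α
  compose-cong {b = b} {p} {p′} I {q} {q′} p≈p′ q≈q′ α = go α (origin p I q α)
    where
    go : ∀ α → Origin p I q α → label (compose p I q) α ≈ label (compose p′ I q′) α
    go α (fromOuter β β≢ refl l) = ≈-trans (≈-reflexive l)
      (≈-trans (p≈p′ β) (≈-reflexive (sym (label-outerArc p′ I q′ β≢))))
    go α (fromInner γ γ≢ refl l) = ≈-trans (≈-reflexive l)
      (≈-trans (q≈q′ γ) (≈-reflexive (sym (label-innerArc p′ I q′ γ≢))))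
    go α (fromGlue refl l) = ≈-trans (≈-reflexive l)
      (≈-trans (∙-cong (p≈p′ _) (q≈q′ _)) (≈-reflexive (sym (label-glue p′ I q′))))
    go α (fromNeither ¬outer ¬inner l) = ≈-trans (≈-reflexive l) (≈-reflexive (sym (label-crossing p′ I q′ ¬outer ¬inner)))

module _ {M N : UnitalMagma m ℓ} (θ : UnitalMagmaHom M N) where
  open UnitalMagma N using (_≈_) renaming (refl to ≈-refl)
  open UnitalMagmaHom θ
  private
    module CM = Cliques M
    module CN = Cliques N

  relabel-compose : (p : CM.Clique (suc a)) (I : [ suc a ]) (q : CM.Clique (suc b)) →
    ∀ α → CN.label (relabel θ (CM.compose p I q)) α ≈ CN.label (CN.compose (relabel θ p) I (relabel θ q)) α
  relabel-compose {b = b} p I q α = go (position (val I) (suc b) (Arc.src α) (Arc.tgt α))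
    where
    go : ∀ pos → ⟦ CM.labelAt p I q α pos ⟧ ≈ CN.labelAt (relabel θ p) I (relabel θ q) α pos
    go (before _)             = ≈-refl
    go (above _ _ _)          = ≈-refl
    go (after _)              = ≈-refl
    go (inside _ _ _)         = ≈-refl
    go (glued _)              = homo _ _
    go (crossing _ _ _ _ _)   = ε-homo

-- The operad of cliques and its functoriality

module CliqueOperad (R : CommutativeRing r ℓr) (M : UnitalMagma m ℓ) where
  open Cliques M
  open Composition M
  open RawOperad (C R M)
  private
    module R = CommutativeRing R
    module Comb a = Combinations R (clique (suc a))

    module Extension {a b} (I : [ suc a ]) =
      Bilinear R (clique (suc a)) (clique (suc b)) (clique (suc (a + b)))
        (λ p q → compose p I q) (compose-cong I)

  cast≡map : (a≡b : a ≡ b) (u : O a) → cast a≡b u ≡ map (map₂ (castClique a≡b)) u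
  cast≡map ≡.refl u = ≡.sym (map-id u)

  isOperad : IsOperad R (C R M)
  isOperad = record
    { isModule = λ a → isModule R (clique (suc a))
    ; linearˡ  = λ I → Extension.⊗-linearˡ I
    ; linearʳ  = λ u I → Extension.⊗-linearʳ I u
    ; series   = λ {a} {b} {c} u v w I J → let open Comb (a + (b + c)) in
        ≋-trans (≋-reflexive (cast≡map (+-assoc a b c) _))
          (CartesianProducts.cartesianProductWith-assoc R (clique (suc (a + (b + c)))) _ _ _ _ _
            (λ (k , p) (l , q) (n , s) → R.*-assoc k l n , series-clique p q s I J) u v w)
    ; parallel = λ {a} {b} {c} u v w I J i<j → let open Comb (a + c + b) in
        ≋-trans (≋-reflexive (cast≡map (+-swapʳ a b c) _))
          (CartesianProducts.cartesianProductWith-interchange R (clique (suc (a + c + b))) _ _ _ _ _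
            (λ (k , p) (l , q) (n , s) → xy∙z≈xz∙y R.*-commutativeSemigroup k l n , parallel-clique p q s I J i<j) u v w)
    ; unitˡ    = λ {a} u → let open Comb a in
        ≋-trans (≋-reflexive (++-identityʳ _))
          (≋-trans (map-pointwise (λ (k , p) → R.*-identityˡ k , unitˡ-clique p) u) (≋-reflexive (map-id u)))
    ; unitʳ    = λ {a} u I → let open Comb a in
        ≋-trans (≋-reflexive (≡.trans (cast≡map (+-identityʳ a) _)
            (≡.trans (≡.cong (map _) (CartesianProducts.cartesianProductWith-[-]ʳ R (clique (suc a)) _ u _)) (≡.sym (map-∘ u)))))
          (≋-trans (map-pointwise (λ (k , p) → R.*-identityʳ k , unitʳ-clique p I) u) (≋-reflexive (map-id u)))
    }

module _ (R : CommutativeRing r ℓr) {M N : UnitalMagma m ℓ} (θ : UnitalMagmaHom M N) where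
  private
    module R = CommutativeRing R
    module M = UnitalMagma M
    module N = UnitalMagma N
    cliqueM cliqueN : ℕ → Setoid (m ⊔ ℓ) ℓ
    cliqueM a = Cliques.clique M (suc a)
    cliqueN a = Cliques.clique N (suc a)
  open UnitalMagmaHom θ

  C₁-isOperadMorphism : IsOperadMorphism (C R M) (C R N) (C₁ R θ)
  C₁-isOperadMorphism = record
    { linear = λ a → Linear.extend-linear R (cliqueM a) (cliqueN a) (relabel θ) (λ p≈q α → ⟦⟧-cong (p≈q α))
    ; unit   = FreeModule.cons R.refl (λ _ → ε-homo) FreeModule.[]
    ; comp   = λ {a} {b} u I v → CartesianProducts.map-cartesianProductWith R (cliqueN (a + b)) _ _ _ _ _
        (λ (_ , p) (_ , q) → R.refl , relabel-compose θ p I q) u v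
    }

  C₁-injective : Injective M._≈_ N._≈_ ⟦_⟧ →
    ∀ a → Injective (RawOperad._≈_ (C R M) {a}) (RawOperad._≈_ (C R N) {a}) (C₁ R θ)
  C₁-injective inj a = extend-injective R (cliqueM a) (cliqueN a) (relabel θ)
    (λ p≈q α → ⟦⟧-cong (p≈q α)) (λ θp≈θq α → inj (θp≈θq α))

  relabel-surjective : Surjective M._≈_ N._≈_ ⟦_⟧ →
    ∀ a → Surjective (Setoid._≈_ (cliqueM a)) (Setoid._≈_ (cliqueN a)) (relabel θ)
  -- A preimage of the unit need not be the unit, so arity 1 is treated apart.
  relabel-surjective surj zero q = Cliques.𝐮 M , λ z≈𝐮 α →
    N.trans (⟦⟧-cong (z≈𝐮 α)) (N.trans ε-homo (N.sym (Cliques.trivial q refl α)))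
  relabel-surjective surj (suc a) q =
    record { label = λ α → proj₁ (surj (Cliques.label q α)) ; trivial = λ () } ,
    λ z≈p α → proj₂ (surj (Cliques.label q α)) (z≈p α)

  C₁-surjective : Surjective M._≈_ N._≈_ ⟦_⟧ →
    ∀ a → Surjective (RawOperad._≈_ (C R M) {a}) (RawOperad._≈_ (C R N) {a}) (C₁ R θ)
  C₁-surjective surj a = extend-surjective R (cliqueM a) (cliqueN a) (relabel θ)
    (λ p≈q α → ⟦⟧-cong (p≈q α)) (relabel-surjective surj a)

theorem2p1p1 : ∀ {k ℓ₁ ℓ₂ m ℓ : Level} (K : HeytingField k ℓ₁ ℓ₂) → CharacteristicZero K →
    Σ[ C-isOperad ∈ ((M : UnitalMagma m ℓ) → IsOperad (scalars K) (C (scalars K) M)) ]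
    Σ[ C₁-isMorphism ∈ ((M N : UnitalMagma m ℓ) (θ : UnitalMagmaHom M N) →
    IsOperadMorphism (C (scalars K) M) (C (scalars K) N) (C₁ (scalars K) θ)) ]
    IsFunctor (UnitalMagmas m ℓ) (Operads (scalars K) (k ⊔ m ⊔ ℓ) (k ⊔ ℓ₁ ⊔ m ⊔ ℓ))
    (λ M → operad (C (scalars K) M) (C-isOperad M))
    (λ {M} {N} θ → operadHom (C₁ (scalars K) θ) (C₁-isMorphism M N θ))
    × ((M N : UnitalMagma m ℓ) (θ : UnitalMagmaHom M N) →
    Injective (UnitalMagma._≈_ M) (UnitalMagma._≈_ N) (UnitalMagmaHom.⟦_⟧ θ) →
    (a : ℕ) → Injective (RawOperad._≈_ (C (scalars K) M) {a})
    (RawOperad._≈_ (C (scalars K) N) {a}) (C₁ (scalars K) θ))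
    × ((M N : UnitalMagma m ℓ) (θ : UnitalMagmaHom M N) →
    Surjective (UnitalMagma._≈_ M) (UnitalMagma._≈_ N) (UnitalMagmaHom.⟦_⟧ θ) →
    (a : ℕ) → Surjective (RawOperad._≈_ (C (scalars K) M) {a})
    (RawOperad._≈_ (C (scalars K) N) {a}) (C₁ (scalars K) θ))
theorem2p1p1 K _ =
  CliqueOperad.isOperad R ,
  (λ M N → C₁-isOperadMorphism R) ,
  record
    { F-resp-≈     = λ {A} {B} θ≈η {a} u → let open Combinations R (Cliques.clique B (suc a)) in
        map-pointwise (λ (_ , p) → R.refl , λ α → θ≈η (Cliques.label p α)) u
    ; identity     = λ {A} {a} u → let open Combinations R (Cliques.clique A (suc a)) in
        ≋-trans (map-pointwise (λ _ → R.refl , λ _ → UnitalMagma.refl A) u) (≋-reflexive (map-id u))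
    ; homomorphism = λ {A} {B} {D} η θ {a} u → let open Combinations R (Cliques.clique D (suc a)) in
        ≋-trans (map-pointwise (λ _ → R.refl , λ _ → UnitalMagma.refl D) u) (≋-reflexive (map-∘ u))
    } ,
  (λ M N → C₁-injective R) ,
  (λ M N → C₁-surjective R)
  where
  R = scalars K
  module R = CommutativeRing R
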